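{- Let $n,d,t$ be positive integers with $d<n$ and $t$ a multiple of $d$. If $$t \ge 2d\log_2\frac{en}{d} + \log_2 n,$$ then the $2t\times n$ random Boolean matrix $M$ constructed by sample-injection is $(d,d)$-resolvable with high probability, that is, with probability at least $1-1/n$.
   Context: Let $M$ be a Boolean matrix with set of columns $C$. For a set $D\subseteq C$ of $d$ columns and a column $j\in C\setminus D$, say that $j$ is distinguishable from $D$ if there is a row $i$ of $M$ with $M[i,j]=1$ and with a $0$ in row $i$ in each of the columns of $D$. The matrix $M$ is $(d,k)$-resolvable if, for every $d$-element subset $D\subseteq C$, there are fewer than $k$ columns in $C\setminus D$ that are not distinguishable from $D$; $(d,d)$-resolvable is the case $k=d$. Sample-injection: given $t$, a multiple of $d$, the random $2t\times n$ matrix $M$ is built column by column: independently for each column, choose $t/d$ of the $2t$ rows uniformly at random, set the entries of the column in these rows to $1$ and all its other entries to $0$. Here $e$ is the base of the natural logarithm. -}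

module Defs where

open import Data.Bool.Base using (Bool; true; false)
import Data.Bool.Properties as Bool
open import Data.Fin.Base using (Fin)
import Data.Fin.Properties as Fin
open import Data.Fin.Subset using (Subset; _∈_; ∣_∣; inside; outside)
open import Data.Fin.Subset.Properties using (_∈?_; anySubset?)
open import Data.Integer.Base using (ℤ; +_; -[1+_])
open import Data.List.Base
  using (List; []; _∷_; [_]; map; foldr; filter; length; allFin; upTo; cartesianProductWith)
open import Data.Nat.Base as ℕ using (ℕ; zero; suc; NonZero; _!)
import Data.Nat.DivMod as ℕ
import Data.Nat.Properties as ℕ
open import Data.Product.Base using (_×_; _,_; proj₁; proj₂; ∃-syntax)
open import Data.Rational.Base
  using (ℚ; 0ℚ; 1ℚ; ½; _/_; _+_; _*_; _<_; _≤_; ↥_; ↧ₙ_; +-*-rawSemiring)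
open import Algebra.Definitions.RawSemiring +-*-rawSemiring using (_^_)
open import Data.Vec.Base as Vec using (Vec; lookup)
open import Level using (0ℓ)
open import Relation.Binary.PropositionalEquality using (_≡_)
open import Relation.Nullary using (Dec; ¬?; _×-dec_; _→-dec_)
open import Relation.Nullary.Decidable using (map′; decidable-stable)
open import Relation.Unary using (Pred; Decidable; _⊆_)

------------------------------------------------------------------------
-- Real numbers

-- A real x is given by its left Dedekind cut, the set of rationals q with
-- q < x.

Real : Set₁
Real = Pred ℚ 0ℓ

infix  4 _≤ᴿ_
infixl 6 _+ᴿ_
infixr 7 _·ᴿ_
infixl 7 _÷ᴿ_

_≤ᴿ_ : Real → Real → Set
x ≤ᴿ y = x ⊆ y

fromℚ : ℚ → Real
fromℚ p q = q < p

fromℕ : ℕ → Real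
fromℕ n = fromℚ (+ n / 1)

_+ᴿ_ : Real → Real → Real
(x +ᴿ y) q = ∃[ r ] ∃[ s ] x r × y s × q ≡ r + s

-- Multiplying a left cut by a number gives a left cut only when the number
-- is positive.

_·ᴿ_ : (n : ℕ) .{{_ : NonZero n}} → Real → Real
(n ·ᴿ x) q = ∃[ r ] x r × q ≡ (+ n / 1) * r

_÷ᴿ_ : Real → (n : ℕ) .{{_ : NonZero n}} → Real
(x ÷ᴿ n) q = x ((+ n / 1) * q)

sumℚ : List ℚ → ℚ
sumℚ = foldr _+_ 0ℚ

1/_! : ℕ → ℚ
1/ k ! = _/_ (+ 1) (k !) {{k ℕ.!≢0}}

-- e = Σ 1/k!; the partial sums increase strictly to e.

e : Real
e q = ∃[ m ] q < sumℚ (map 1/_! (upTo m))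

2^_ : ℤ → ℚ
2^ (+ n)    = (+ 2 / 1) ^ n
2^ -[1+ n ] = ½ ^ suc n

-- For a rational q = a / b with b > 0 and a real x > 0: q < log₂ x iff
-- 2^(a/b) < x iff 2^(a/b) ≤ r for some rational 0 < r < x, and
-- 2^(a/b) ≤ r iff 2^a ≤ r^b.

log₂ : Real → Real
log₂ x q = ∃[ r ] 0ℚ < r × x r × 2^ (↥ q) ≤ r ^ (↧ₙ q)

------------------------------------------------------------------------
-- Boolean matrices and resolvability

BoolMatrix : ℕ → ℕ → Set
BoolMatrix m n = Fin m → Fin n → Bool

module _ {m n : ℕ} (M : BoolMatrix m n) where

  Distinguishable : Subset n → Fin n → Set
  Distinguishable D j = ∃[ i ] (M i j ≡ true × (∀ k → k ∈ D → M i k ≡ false))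

  distinguishable? : ∀ D → Decidable (Distinguishable D)
  distinguishable? D j = Fin.any? λ i →
    (M i j Bool.≟ true) ×-dec Fin.all? λ k → (k ∈? D) →-dec (M i k Bool.≟ false)

  indistinguishable : Subset n → List (Fin n)
  indistinguishable D =
    filter (λ j → ¬? (j ∈? D) ×-dec ¬? (distinguishable? D j)) (allFin n)

  Resolvable : ℕ → ℕ → Set
  Resolvable d k = ∀ (D : Subset n) → ∣ D ∣ ≡ d → length (indistinguishable D) ℕ.< k

allSubset? : ∀ {n} {P : Pred (Subset n) 0ℓ} → Decidable P → Dec (∀ p → P p)
allSubset? P? = map′
  (λ ¬∃ p → decidable-stable (P? p) (λ ¬Pp → ¬∃ (p , ¬Pp)))
  (λ ∀P (p , ¬Pp) → ¬Pp (∀P p))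
  (¬? (anySubset? (λ p → ¬? (P? p))))

resolvable? : ∀ {m n} d k → Decidable {A = BoolMatrix m n} (λ M → Resolvable M d k)
resolvable? d k M = allSubset? λ D →
  (∣ D ∣ ℕ.≟ d) →-dec (length (indistinguishable M D) ℕ.<? k)

------------------------------------------------------------------------
-- Finite probability distributions

-- A list of outcomes with their probabilities.

Dist : Set → Set
Dist A = List (A × ℚ)

private variable
  A B : Set

mapDist : (A → B) → Dist A → Dist B
mapDist f = map λ (a , p) → f a , p

-- Only meaningful for a non-empty list without repetitions.

uniform : List A → Dist A
uniform []           = []
uniform xs@(_ ∷ xs′) = map (λ x → x , + 1 / suc (length xs′)) xs

independent : Dist A → ∀ n → Dist (Vec A n)
independent μ zero    = [ (Vec.[] , 1ℚ) ]
independent μ (suc n) =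
  cartesianProductWith (λ (a , p) (as , q) → a Vec.∷ as , p * q) μ (independent μ n)

Pr : Dist A → {P : Pred A 0ℓ} → Decidable P → ℚ
Pr μ P? = sumℚ (map proj₂ (filter (λ ω → P? (proj₁ ω)) μ))

------------------------------------------------------------------------
-- Sample-injection

subsets : ∀ m → List (Subset m)
subsets zero    = [ Vec.[] ]
subsets (suc m) = cartesianProductWith Vec._∷_ (inside ∷ outside ∷ []) (subsets m)

subsetsOfSize : ∀ m → ℕ → List (Subset m)
subsetsOfSize m k = filter (λ p → ∣ p ∣ ℕ.≟ k) (subsets m)

-- A set of rows is its own characteristic vector (inside = true), so it is
-- the Boolean column with ones exactly in these rows.

fromColumns : ∀ {m n} → Vec (Subset m) n → BoolMatrix m n
fromColumns cs i j = lookup (lookup cs j) i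

sampleInjection : ∀ n d t .{{_ : NonZero d}} → Dist (BoolMatrix (2 ℕ.* t) n)
sampleInjection n d t =
  mapDist fromColumns (independent (uniform (subsetsOfSize (2 ℕ.* t) (t ℕ./ d))) n)

module Submission where

-- Fix sets D and J of d columns each.  The columns in D have at most t ones
-- altogether, so a further column with t/d ones is covered by them with
-- probability at most C(t,t/d) / C(2t,t/d) ≤ 2^(-t/d), independently for the
-- columns in J; hence all of J is covered with probability at most 2^(-t).
-- If M is not (d,d)-resolvable, this happens for one of the at most
-- C(n,d)² ≤ (en/d)^(2d) pairs (D,J), and the hypothesis on t says that
-- (en/d)^(2d) n ≤ 2^t.

open import Defs
open import Algebra.Bundles using (CommutativeRing)
open import Data.Bool.Base using (true; false; if_then_else_)
open import Data.Fin.Base using (Fin; zero; suc)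
open import Data.Fin.Subset using (Subset; inside; outside)
open import Data.List.Base using (List; []; _∷_; [_]; _++_; _∷ʳ_; map; filter; length; tabulate; upTo; cartesianProductWith)
open import Data.List.Properties using (map-++; map-∘; upTo-∷ʳ)
open import Data.Nat.Base using (ℕ; zero; suc; NonZero; _<_; _!)
open import Data.Nat.Combinatorics using (nCk+nC[k+1]≡[n+1]C[k+1]) renaming (_C_ to infix 8 _choose_)
open import Data.Nat.Divisibility using (_∣_)
open import Data.Nat.Tactic.RingSolver using (solve-∀)
open import Data.Product.Base using (_×_; _,_; proj₁; proj₂; ∃-syntax; map₂)
open import Data.Sum.Base using (inj₂)
open import Data.Vec.Base as Vec using (Vec; lookup)
open import Function.Base using (_∘_; id)
open import Level using (0ℓ)
open import Relation.Binary.PropositionalEquality using (_≡_; refl; sym; trans; cong; cong₂; subst; module ≡-Reasoning)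
open import Relation.Nullary using (Dec; does; yes; no; ¬_; ¬?; contradiction)
open import Relation.Unary using (Pred; Decidable)

-- Binomial coefficients, the exponential series and logarithms in ℕ

-- The hypothesis compares left Dedekind cuts, so it speaks only of rationals strictly below the two
-- logarithms; the work lies in getting an exact inequality of integers out of it. Three
-- approximations have to cost nothing. The number e is replaced by its partial sum s through 1/d!,
-- since C(n,d) ≤ (n s / d)^d holds already for this s. The n under the second logarithm is replaced
-- by a rational below it, and integrality of both sides of C(n,d)² n ≤ 2^t closes the gap. The
-- logarithms are replaced by fractions a/b, with b so large that the rounding is harmless.
-- Denominators are cleared, so the estimates take place in ℕ. On the probabilistic side all
-- outcomes have the same weight, so probabilities are counts over a list of column vectors. This
-- list is built one column at a time, while D and J may interleave in any order; hence the counting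
-- carries a base set that collects the columns of D met so far. A column of J is compared with the
-- columns of D on both sides of it, so independence takes the form of exchanging two sums.

module _ where

  open import Data.Nat.Base
  open import Data.Nat.Properties
  open ≤-Reasoning

  ^-distribʳ-* : ∀ m n k → (m * n) ^ k ≡ m ^ k * n ^ k
  ^-distribʳ-* m n zero    = refl
  ^-distribʳ-* m n (suc k) rewrite ^-distribʳ-* m n k = lemma m n (m ^ k) (n ^ k)
    where
    lemma : ∀ a b x y → a * b * (x * y) ≡ a * x * (b * y)
    lemma = solve-∀

  -- The first two terms of the binomial expansion of (x+1)^(k+1). They serve to amplify a strict
  -- inequality, to compare exponential series term by term, and to bound binomial coefficients.
  bernoulli : ∀ x k → x ^ suc k + suc k * x ^ k ≤ suc x ^ suc k
  bernoulli x zero    = ≤-reflexive (lemma x)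
    where
    lemma : ∀ x → x * 1 + 1 ≡ (1 + x) * 1
    lemma = solve-∀
  bernoulli x (suc k) = begin
    x * (x * y) + (2 + k) * (x * y)              ≤⟨ m≤m+n _ (suc k * y) ⟩
    x * (x * y) + (2 + k) * (x * y) + suc k * y  ≡⟨ lemma x k y ⟩
    suc x * (x * y + suc k * y)                  ≤⟨ *-monoʳ-≤ (suc x) (bernoulli x k) ⟩
    suc x * suc x ^ suc k                        ∎
    where
    y = x ^ k
    lemma : ∀ x k y → x * (x * y) + (2 + k) * (x * y) + (1 + k) * y ≡ (1 + x) * (x * y + (1 + k) * y)
    lemma = solve-∀

  -- Integer logarithms

  n<2^n : ∀ n → n < 2 ^ n
  n<2^n zero    = s≤s z≤n
  n<2^n (suc n) = begin-strict
    suc n              <⟨ s≤s (n<2^n n) ⟩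
    1 + 2 ^ n          ≤⟨ +-monoˡ-≤ _ (m^n>0 2 n) ⟩
    2 ^ n + 2 ^ n      ≡⟨ cong (2 ^ n +_) (sym (+-identityʳ _)) ⟩
    2 ^ suc n          ∎

  floor-log₂ : ∀ x y .{{_ : NonZero y}} → y ≤ x → ∃[ a ] 2 ^ a * y ≤ x × x < 2 ^ suc a * y
  -- The inequality x < 2^x supplies the starting exponent; the search descends from x and keeps the
  -- upper bound as its invariant.
  floor-log₂ x y x≥y = search x (<-≤-trans (n<2^n x) (m≤m*n _ y))
    where
    search : ∀ k → x < 2 ^ k * y → ∃[ a ] 2 ^ a * y ≤ x × x < 2 ^ suc a * y
    search zero    x<y = contradiction (≤-trans (≤-reflexive (+-identityʳ y)) x≥y) (<⇒≱ x<y)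
    search (suc k) x<2y with 2 ^ k * y ≤? x
    ... | yes y≤x = k , y≤x , x<2y
    ... | no  y≰x = search k (≰⇒> y≰x)

  -- For integers, v < u means a ratio of at least 1 + 1/v, and by Bernoulli's inequality the powers
  -- of this ratio reach any given K.
  power-gap : ∀ {u v} K → v < u → .{{_ : NonZero v}} → K * v ^ suc (K * v) ≤ u ^ suc (K * v)
  power-gap {u} {v} K v<u = begin
    K * (v * v ^ b)                  ≡⟨ *-assoc K v _ ⟨
    b * v ^ b                        ≤⟨ m≤n+m _ (v ^ suc b + v ^ b) ⟩
    v ^ suc b + v ^ b + b * v ^ b    ≡⟨ +-assoc (v ^ suc b) _ _ ⟩
    v ^ suc b + suc b * v ^ b        ≤⟨ bernoulli v b ⟩
    suc v ^ suc b                    ≤⟨ ^-monoˡ-≤ (suc b) v<u ⟩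
    u ^ suc b                        ∎
    where b = K * v

  -- The hypothesis says D a₁ + a₂ < t b whenever a₁/b ≤ log₂ (p/q) and
  -- a₂/b ≤ log₂ (p′/q′).  Rounding both logarithms down to multiples of 1/b
  -- costs a factor of at most 2^(D+1) in the b-th power of (p/q)^D (p′/q′),
  -- which is negligible against 2^t for large b.

  antilog : ∀ {p q p′ q′} .{{_ : NonZero q}} .{{_ : NonZero q′}} D t → q ≤ p → q′ ≤ p′ →
    (∀ a₁ a₂ b .{{_ : NonZero b}} → 2 ^ a₁ * q ^ b ≤ p ^ b → 2 ^ a₂ * q′ ^ b ≤ p′ ^ b →
      D * a₁ + a₂ < t * b) →
    p ^ D * p′ ≤ 2 ^ t * (q ^ D * q′)
  antilog {p} {q} {p′} {q′} D t q≤p q′≤p′ hyp with p ^ D * p′ ≤? 2 ^ t * (q ^ D * q′)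
  ... | yes le = le
  ... | no  ¬le = contradiction (hyp a₁ a₂ b lo₁ lo₂) (≤⇒≯ tb≤)
    where
    instance
      _ : NonZero (q ^ D * q′)
      _ = m*n≢0 (q ^ D) q′ {{m^n≢0 q D}}
      _ : NonZero (2 ^ t)
      _ = m^n≢0 2 t
      v≢0 : NonZero (2 ^ t * (q ^ D * q′))
      v≢0 = m*n≢0 (2 ^ t) (q ^ D * q′)
    K = 2 ^ suc D
    -- The exponent at which `power-gap` separates the two sides of the negated goal by the factor
    -- `K`.
    b = suc (K * (2 ^ t * (q ^ D * q′)))
    instance
      q^b≢0 : NonZero (q ^ b)
      q^b≢0 = m^n≢0 q b
      q′^b≢0 : NonZero (q′ ^ b)
      q′^b≢0 = m^n≢0 q′ b
      z≢0 : NonZero ((q ^ b) ^ D * q′ ^ b)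
      z≢0 = m*n≢0 ((q ^ b) ^ D) (q′ ^ b) {{m^n≢0 (q ^ b) D}}
    fl₁ = floor-log₂ (p ^ b) (q ^ b) (^-monoˡ-≤ b q≤p)
    fl₂ = floor-log₂ (p′ ^ b) (q′ ^ b) (^-monoˡ-≤ b q′≤p′)
    a₁ = proj₁ fl₁
    a₂ = proj₁ fl₂
    lo₁ = proj₁ (proj₂ fl₁)
    hi₁ = proj₂ (proj₂ fl₁)
    lo₂ = proj₁ (proj₂ fl₂)
    hi₂ = proj₂ (proj₂ fl₂)
    ^-swap : ∀ x m n → (x ^ m) ^ n ≡ (x ^ n) ^ m
    ^-swap x m n = trans (^-*-assoc x m n) (trans (cong (x ^_) (*-comm m n)) (sym (^-*-assoc x n m)))
    distrib : ∀ x y → (x ^ D * y) ^ b ≡ (x ^ b) ^ D * y ^ b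
    distrib x y = trans (^-distribʳ-* (x ^ D) y b) (cong (_* y ^ b) (^-swap x D b))
    rearrange₁ : ∀ x y z → x * (y * z) ≡ y * x * z
    rearrange₁ = solve-∀
    rearrange₂ : ∀ x y z w → x * y * (z * w) ≡ x * z * (y * w)
    rearrange₂ = solve-∀
    exponents : ∀ D a₁ a₂ → D * (1 + a₁) + (1 + a₂) ≡ D * a₁ + a₂ + (1 + D)
    exponents = solve-∀
    powers : 2 ^ (t * b + suc D) * ((q ^ b) ^ D * q′ ^ b) ≤
             2 ^ (D * a₁ + a₂ + suc D) * ((q ^ b) ^ D * q′ ^ b)
    powers = begin
      2 ^ (t * b + suc D) * ((q ^ b) ^ D * q′ ^ b)
        ≡⟨ cong (_* ((q ^ b) ^ D * q′ ^ b)) (^-distribˡ-+-* 2 (t * b) (suc D)) ⟩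
      2 ^ (t * b) * K * ((q ^ b) ^ D * q′ ^ b)
        ≡⟨ cong₂ (λ x y → x * K * y) (^-*-assoc 2 t b) (distrib q q′) ⟨
      (2 ^ t) ^ b * K * (q ^ D * q′) ^ b
        ≡⟨ rearrange₁ K ((2 ^ t) ^ b) _ ⟨
      K * ((2 ^ t) ^ b * (q ^ D * q′) ^ b)
        ≡⟨ cong (K *_) (^-distribʳ-* (2 ^ t) (q ^ D * q′) b) ⟨
      K * (2 ^ t * (q ^ D * q′)) ^ b
        ≤⟨ power-gap K (≰⇒> ¬le) ⟩
      (p ^ D * p′) ^ b
        ≡⟨ distrib p p′ ⟩
      (p ^ b) ^ D * p′ ^ b
        ≤⟨ *-mono-≤ (^-monoˡ-≤ D (<⇒≤ hi₁)) (<⇒≤ hi₂) ⟩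
      (2 ^ suc a₁ * q ^ b) ^ D * (2 ^ suc a₂ * q′ ^ b)
        ≡⟨ cong (_* (2 ^ suc a₂ * q′ ^ b)) (^-distribʳ-* (2 ^ suc a₁) (q ^ b) D) ⟩
      (2 ^ suc a₁) ^ D * (q ^ b) ^ D * (2 ^ suc a₂ * q′ ^ b)
        ≡⟨ rearrange₂ ((2 ^ suc a₁) ^ D) ((q ^ b) ^ D) (2 ^ suc a₂) (q′ ^ b) ⟩
      (2 ^ suc a₁) ^ D * 2 ^ suc a₂ * ((q ^ b) ^ D * q′ ^ b)
        ≡⟨ cong (λ x → x * 2 ^ suc a₂ * ((q ^ b) ^ D * q′ ^ b))
             (trans (^-*-assoc 2 (suc a₁) D) (cong (2 ^_) (*-comm (suc a₁) D))) ⟩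
      2 ^ (D * suc a₁) * 2 ^ suc a₂ * ((q ^ b) ^ D * q′ ^ b)
        ≡⟨ cong (_* ((q ^ b) ^ D * q′ ^ b)) (^-distribˡ-+-* 2 (D * suc a₁) (suc a₂)) ⟨
      2 ^ (D * suc a₁ + suc a₂) * ((q ^ b) ^ D * q′ ^ b)
        ≡⟨ cong (λ x → 2 ^ x * ((q ^ b) ^ D * q′ ^ b)) (exponents D a₁ a₂) ⟩
      2 ^ (D * a₁ + a₂ + suc D) * ((q ^ b) ^ D * q′ ^ b)
        ∎
    tb≤ : t * b ≤ D * a₁ + a₂
    tb≤ with t * b ≤? D * a₁ + a₂
    ... | yes le  = le
    ... | no  ¬le = contradiction (*-cancelʳ-≤ _ _ ((q ^ b) ^ D * q′ ^ b) powers)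
                      (<⇒≱ (^-monoʳ-< 2 (s≤s (s≤s z≤n)) (+-monoˡ-< (suc D) (≰⇒> ¬le))))

  -- expSum m / m ! = Σ_{i ≤ m} 1 / i !

  expSum : ℕ → ℕ
  expSum zero    = 1
  expSum (suc m) = suc m * expSum m + 1

  -- scaledExp k j m / (k ^ m * m !) = Σ_{i ≤ m} (j / k) ^ i / i !

  scaledExp : ℕ → ℕ → ℕ → ℕ
  scaledExp k j zero    = 1
  scaledExp k j (suc m) = suc m * k * scaledExp k j m + j ^ suc m

  -- The truncated version of (1 + 1/k) exp (j/k) ≤ exp ((j+1)/k), which holds
  -- term by term as j ^ i + i j ^ (i-1) ≤ (j+1) ^ i.

  scaledExp-step : ∀ k j m →
    suc k * suc m * scaledExp k j m + j ^ suc m ≤ scaledExp k (suc j) (suc m)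
  scaledExp-step k j zero = ≤-reflexive (lemma k j)
    where
    lemma : ∀ k j → (1 + k) * 1 * 1 + j * 1 ≡ 1 * k * 1 + (1 + j) * 1
    lemma = solve-∀
  scaledExp-step k j (suc m) = begin
    suc k * suc (suc m) * (suc m * k * E + x) + j * x
      ≡⟨ lemma k j m E x ⟩
    suc (suc m) * k * (suc k * suc m * E + x) + (j * x + suc (suc m) * x)
      ≤⟨ +-mono-≤ (*-monoʳ-≤ (suc (suc m) * k) (scaledExp-step k j m)) (bernoulli j (suc m)) ⟩
    scaledExp k (suc j) (suc (suc m))
      ∎
    where
    E = scaledExp k j m
    x = j ^ suc m
    lemma : ∀ k j m E x →
      (1 + k) * (2 + m) * ((1 + m) * k * E + x) + j * x ≡
      (2 + m) * k * ((1 + k) * (1 + m) * E + x) + (j * x + (2 + m) * x)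
    lemma = solve-∀

  -- Iterating (1 + 1/k) exp (i/k) ≤ exp ((i+1)/k) from exp 0 = 1 gives (1 + 1/k)^j ≤ exp (j/k).
  -- Each step lengthens the truncated series by one term, so j steps end at order j.
  scaledExp-diagonal : ∀ k j → suc k ^ j * j ! ≤ scaledExp k j j
  scaledExp-diagonal k zero    = ≤-refl
  scaledExp-diagonal k (suc j) = begin
    suc k * suc k ^ j * (suc j * j !)           ≡⟨ lemma (suc k) (suc k ^ j) (suc j) (j !) ⟩
    suc k * suc j * (suc k ^ j * j !)           ≤⟨ *-monoʳ-≤ (suc k * suc j) (scaledExp-diagonal k j) ⟩
    suc k * suc j * scaledExp k j j             ≤⟨ m≤m+n _ _ ⟩
    suc k * suc j * scaledExp k j j + j ^ suc j ≤⟨ scaledExp-step k j j ⟩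
    scaledExp k (suc j) (suc j)                 ∎
    where
    lemma : ∀ a b c d → a * b * (c * d) ≡ a * c * (b * d)
    lemma = solve-∀

  scaledExp-expSum : ∀ k m → scaledExp k k m ≡ k ^ m * expSum m
  scaledExp-expSum k zero    = refl
  scaledExp-expSum k (suc m) rewrite scaledExp-expSum k m = lemma k m (k ^ m) (expSum m)
    where
    lemma : ∀ k m x s → (1 + m) * k * (x * s) + k * x ≡ k * x * ((1 + m) * s + 1)
    lemma = solve-∀

  -- The additional l terms of the series are positive. They are allowed so that the factors (1 +
  -- 1/i)^i for different i can all be compared with one and the same partial sum.
  1+1/k^k≤expSum : ∀ k l → suc k ^ k * (l + k) ! ≤ k ^ k * expSum (l + k)
  1+1/k^k≤expSum k zero    = ≤-trans (scaledExp-diagonal k k) (≤-reflexive (scaledExp-expSum k k))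
  1+1/k^k≤expSum k (suc l) = begin
    suc k ^ k * (suc (l + k) * (l + k) !)  ≡⟨ lemma (suc k ^ k) (suc (l + k)) _ ⟩
    suc (l + k) * (suc k ^ k * (l + k) !)  ≤⟨ *-monoʳ-≤ (suc (l + k)) (1+1/k^k≤expSum k l) ⟩
    suc (l + k) * (k ^ k * expSum (l + k)) ≡⟨ lemma (k ^ k) (suc (l + k)) _ ⟨
    k ^ k * (suc (l + k) * expSum (l + k)) ≤⟨ *-monoʳ-≤ (k ^ k) (m≤m+n _ 1) ⟩
    k ^ k * expSum (suc (l + k))           ∎
    where
    lemma : ∀ a b c → a * (b * c) ≡ b * (a * c)
    lemma = solve-∀

  m!≤expSum : ∀ m → m ! ≤ expSum m
  m!≤expSum zero    = ≤-refl
  m!≤expSum (suc m) = ≤-trans (*-monoʳ-≤ (suc m) (m!≤expSum m)) (m≤m+n _ 1)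

  -- Multiply (1 + 1/i)^i ≤ e over i < k.

  k^k≤k!*e^k : ∀ {m} k → k ≤ m → k ^ k * (m !) ^ k ≤ k ! * expSum m ^ k
  k^k≤k!*e^k     zero    _   = ≤-refl
  k^k≤k!*e^k {m} (suc k) k<m = begin
    suc k * suc k ^ k * (m ! * (m !) ^ k)          ≡⟨ lemma₁ (suc k) (suc k ^ k) (m !) _ ⟩
    suc k * (m !) ^ k * (suc k ^ k * m !)          ≤⟨ *-monoʳ-≤ (suc k * (m !) ^ k) ratio ⟩
    suc k * (m !) ^ k * (k ^ k * expSum m)         ≡⟨ lemma₂ (suc k) ((m !) ^ k) (k ^ k) (expSum m) ⟩
    suc k * expSum m * (k ^ k * (m !) ^ k)         ≤⟨ *-monoʳ-≤ (suc k * expSum m) (k^k≤k!*e^k k (<⇒≤ k<m)) ⟩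
    suc k * expSum m * (k ! * expSum m ^ k)        ≡⟨ lemma₃ (suc k) (expSum m) (k !) (expSum m ^ k) ⟩
    suc k * k ! * (expSum m * expSum m ^ k)        ∎
    where
    ratio : suc k ^ k * m ! ≤ k ^ k * expSum m
    ratio = subst (λ i → suc k ^ k * i ! ≤ k ^ k * expSum i) (m∸n+n≡m (<⇒≤ k<m)) (1+1/k^k≤expSum k (m ∸ k))
    lemma₁ : ∀ a b c d → a * b * (c * d) ≡ a * d * (b * c)
    lemma₁ = solve-∀
    lemma₂ : ∀ a b c d → a * b * (c * d) ≡ a * d * (c * b)
    lemma₂ = solve-∀
    lemma₃ : ∀ a b c d → a * b * (c * d) ≡ a * c * (b * d)
    lemma₃ = solve-∀

  -- Estimates for binomial coefficients

  choose*!≤^ : ∀ n k → n choose k * k ! ≤ n ^ k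
  choose*!≤^ n       zero    = ≤-refl
  choose*!≤^ zero    (suc k) = z≤n
  choose*!≤^ (suc n) (suc k) rewrite sym (nCk+nC[k+1]≡[n+1]C[k+1] n k) = begin
    (n choose k + n choose suc k) * (suc k * k !)              ≡⟨ lemma (n choose k) (n choose suc k) (suc k) (k !) ⟩
    n choose suc k * (suc k) ! + suc k * (n choose k * k !)    ≤⟨ +-mono-≤ (choose*!≤^ n (suc k)) (*-monoʳ-≤ (suc k) (choose*!≤^ n k)) ⟩
    n ^ suc k + suc k * n ^ k                                  ≤⟨ bernoulli n k ⟩
    suc n ^ suc k                                              ∎
    where
    lemma : ∀ a b c d → (a + b) * (c * d) ≡ b * (c * d) + c * (a * d)
    lemma = solve-∀

  -- The absorption identity (k+1) C(n,k+1) = (n-k) C(n,k) without subtraction, which lets Pascal's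
  -- rule carry the induction.
  choose-absorb : ∀ n k → suc k * n choose suc k + k * n choose k ≡ n * n choose k
  choose-absorb zero    zero    = refl
  choose-absorb zero    (suc k) rewrite *-zeroʳ k = refl
  choose-absorb (suc n) zero    rewrite sym (nCk+nC[k+1]≡[n+1]C[k+1] n 0) = begin-equality
    1 * (1 + n choose 1) + 0  ≡⟨ lemma (n choose 1) ⟩
    1 + (1 * n choose 1 + 0)  ≡⟨ cong suc (choose-absorb n 0) ⟩
    suc (n * 1)               ∎
    where
    lemma : ∀ x → 1 * (1 + x) + 0 ≡ 1 + (1 * x + 0)
    lemma = solve-∀
  choose-absorb (suc n) (suc k) = begin-equality
    suc (suc k) * suc n choose suc (suc k) + suc k * suc n choose suc k
      ≡⟨ cong₂ (λ x y → suc (suc k) * x + suc k * y) (nCk+nC[k+1]≡[n+1]C[k+1] n (suc k)) (nCk+nC[k+1]≡[n+1]C[k+1] n k) ⟨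
    suc (suc k) * (b + c) + suc k * (a + b)
      ≡⟨ lemma k a b c ⟩
    a + b + ((suc k * b + k * a) + (suc (suc k) * c + suc k * b))
      ≡⟨ cong₂ (λ x y → a + b + (x + y)) (choose-absorb n k) (choose-absorb n (suc k)) ⟩
    a + b + (n * a + n * b)
      ≡⟨ lemma′ n a b ⟩
    suc n * (a + b)
      ≡⟨ cong (suc n *_) (nCk+nC[k+1]≡[n+1]C[k+1] n k) ⟩
    suc n * suc n choose suc k
      ∎
    where
    a = n choose k
    b = n choose suc k
    c = n choose suc (suc k)
    lemma : ∀ k a b c →
      (2 + k) * (b + c) + (1 + k) * (a + b) ≡ a + b + (((1 + k) * b + k * a) + ((2 + k) * c + (1 + k) * b))
    lemma = solve-∀
    lemma′ : ∀ n a b → a + b + (n * a + n * b) ≡ (1 + n) * (a + b)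
    lemma′ = solve-∀

  -- Factor by factor: passing from t to 2t replaces t - i by 2t - i ≥ 2 (t - i) for each i < w.
  -- Truncated subtraction does no harm if w exceeds t.
  choose-double : ∀ t w → 2 ^ w * t choose w ≤ (2 * t) choose w
  choose-double t zero    = ≤-refl
  choose-double t (suc w) = *-cancelˡ-≤ (suc w) (begin
    suc w * (2 * 2 ^ w * t choose suc w)            ≡⟨ lemma (suc w) (2 ^ w) (t choose suc w) ⟩
    2 * 2 ^ w * (suc w * t choose suc w)            ≡⟨ cong (2 * 2 ^ w *_) (absorb∸ t w) ⟩
    2 * 2 ^ w * ((t ∸ w) * t choose w)              ≡⟨ lemma′ (2 ^ w) (t ∸ w) (t choose w) ⟩
    2 * (t ∸ w) * (2 ^ w * t choose w)              ≤⟨ *-mono-≤ 2[t∸w]≤2t∸w (choose-double t w) ⟩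
    (2 * t ∸ w) * (2 * t) choose w                  ≡⟨ absorb∸ (2 * t) w ⟨
    suc w * (2 * t) choose suc w                    ∎)
    where
    absorb∸ : ∀ n k → suc k * n choose suc k ≡ (n ∸ k) * n choose k
    absorb∸ n k = trans (sym (m+n∸n≡m _ (k * n choose k)))
      (trans (cong (_∸ k * n choose k) (choose-absorb n k)) (sym (*-distribʳ-∸ (n choose k) n k)))
    2[t∸w]≤2t∸w : 2 * (t ∸ w) ≤ 2 * t ∸ w
    2[t∸w]≤2t∸w = ≤-trans (≤-reflexive (*-distribˡ-∸ 2 t w)) (∸-monoʳ-≤ (2 * t) (m≤n*m w 2))
    lemma : ∀ a b c → a * (2 * b * c) ≡ 2 * b * (a * c)
    lemma = solve-∀
    lemma′ : ∀ a b c → 2 * a * (b * c) ≡ 2 * b * (a * c)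
    lemma′ = solve-∀

  -- C(n,d) ≤ n^d / d ! and d^d / d ! ≤ e^d.

  choose≤[en/d]^d : ∀ n d → n choose d * (d * d !) ^ d ≤ (n * expSum d) ^ d
  choose≤[en/d]^d n d = *-cancelˡ-≤ (d !) {{d !≢0}} (begin
    d ! * (n choose d * (d * d !) ^ d)              ≡⟨ cong (λ x → d ! * (n choose d * x)) (^-distribʳ-* d (d !) d) ⟩
    d ! * (n choose d * (d ^ d * (d !) ^ d))        ≡⟨ lemma (d !) (n choose d) _ ⟩
    n choose d * d ! * (d ^ d * (d !) ^ d)          ≤⟨ *-mono-≤ (choose*!≤^ n d) (k^k≤k!*e^k d ≤-refl) ⟩
    n ^ d * (d ! * expSum d ^ d)                    ≡⟨ lemma′ (n ^ d) (d !) _ ⟩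
    d ! * (n ^ d * expSum d ^ d)                    ≡⟨ cong (d ! *_) (^-distribʳ-* n (expSum d) d) ⟨
    d ! * (n * expSum d) ^ d                        ∎)
    where
    lemma : ∀ a b c → a * (b * c) ≡ b * a * c
    lemma = solve-∀
    lemma′ : ∀ a b c → a * (b * c) ≡ b * (a * c)
    lemma′ = solve-∀

  -- It suffices to take p / q = n − 1 / (c² + 1), as c² n and D are integers.

  square-bound : ∀ c n D → 1 < n →
    (∀ p q .{{_ : NonZero q}} → q ≤ p → p < n * q → c * c * p ≤ D * q) → c * c * n ≤ D
  square-bound c n D 1<n hyp with c * c * n ≤? D
  ... | yes le = le
  ... | no ¬le = contradiction bound (<⇒≱ (+-monoʳ-< (D * q) (n<1+n (c * c))))
    where
    q = suc (c * c)
    p = n * q ∸ 1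
    p+1≡nq : p + 1 ≡ n * q
    p+1≡nq = m∸n+n≡m (≤-trans (<⇒≤ 1<n) (m≤m*n n q))
    -- Since n is at least 2, the rational n - 1/q is still at least 1, so its logarithm is
    -- nonnegative and can be rounded down in ℕ.
    q≤p : q ≤ p
    q≤p = +-cancelʳ-≤ 1 q p (begin
      q + 1    ≤⟨ +-monoʳ-≤ q (s≤s z≤n) ⟩
      q + q    ≡⟨ cong (q +_) (sym (+-identityʳ q)) ⟩
      2 * q    ≤⟨ *-monoˡ-≤ q 1<n ⟩
      n * q    ≡⟨ p+1≡nq ⟨
      p + 1    ∎)
    p<nq : p < n * q
    p<nq = ≤-reflexive (trans (+-comm 1 p) p+1≡nq)
    lemma : ∀ x y → x * (y + 1) ≡ x * y + x
    lemma = solve-∀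
    bound : D * q + q ≤ D * q + c * c
    bound = begin
      D * q + q              ≡⟨ +-comm (D * q) q ⟩
      suc D * q              ≤⟨ *-monoˡ-≤ q (≰⇒> ¬le) ⟩
      c * c * n * q          ≡⟨ *-assoc (c * c) n q ⟩
      c * c * (n * q)        ≡⟨ cong (c * c *_) p+1≡nq ⟨
      c * c * (p + 1)        ≡⟨ lemma (c * c) p ⟩
      c * c * p + c * c      ≤⟨ +-monoˡ-≤ (c * c) (hyp p q q≤p p<nq) ⟩
      D * q + c * c          ∎

-- Counting the unresolvable matrices

module _ where

  open import Data.Fin.Subset using (⊥; ⊤; _∪_; _∈_; _∉_; _⊆_; ∣_∣)
  open import Data.Fin.Subset.Properties using (_∈?_; _⊆?_; drop-∷-⊆; s⊆s; out⊆; p⊆p∪q; q⊆p∪q; ∣⊥∣≡0; ∣⊤∣≡n; ⊆⊤; ∉⊥)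
  open import Data.List.Membership.Propositional using () renaming (_∈_ to _∈ˡ_)
  open import Data.List.Membership.Propositional.Properties using (∈-filter⁺; ∈-filter⁻; ∈-cartesianProductWith⁺; ∈-cartesianProductWith⁻)
  open import Data.List.Relation.Unary.Any using (here; there)
  open import Data.Nat.Base
  open import Data.Nat.ListAction using (sum)
  open import Data.Nat.ListAction.Properties using (sum-++)
  open import Data.Nat.Properties
  open import Data.Vec.Properties using ([]=⇒lookup; lookup⇒[]=)
  open ≤-Reasoning

  -- Finite sums and indicators

  ∑ : {A : Set} → List A → (A → ℕ) → ℕ
  ∑ xs f = sum (map f xs)

  𝟙 : {P : Set} → Dec P → ℕ
  𝟙 P? = if does P? then 1 else 0

  ∑-mono : {A : Set} (xs : List A) {f g : A → ℕ} → (∀ {x} → x ∈ˡ xs → f x ≤ g x) → ∑ xs f ≤ ∑ xs g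
  ∑-mono []       f≤g = z≤n
  ∑-mono (x ∷ xs) f≤g = +-mono-≤ (f≤g (here refl)) (∑-mono xs (f≤g ∘ there))

  ∑-cong : {A : Set} (xs : List A) {f g : A → ℕ} → (∀ x → f x ≡ g x) → ∑ xs f ≡ ∑ xs g
  ∑-cong []       f≡g = refl
  ∑-cong (x ∷ xs) f≡g = cong₂ _+_ (f≡g x) (∑-cong xs f≡g)

  ∑-const : {A : Set} (xs : List A) (c : ℕ) → ∑ xs (λ _ → c) ≡ length xs * c
  ∑-const []       c = refl
  ∑-const (x ∷ xs) c = cong (c +_) (∑-const xs c)

  ∑-*ˡ : {A : Set} (xs : List A) (c : ℕ) {f : A → ℕ} → ∑ xs (λ x → c * f x) ≡ c * ∑ xs f
  ∑-*ˡ []       c     = sym (*-zeroʳ c)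
  ∑-*ˡ (x ∷ xs) c {f} = trans (cong (c * f x +_) (∑-*ˡ xs c)) (sym (*-distribˡ-+ c (f x) _))

  ∑-+ : {A : Set} (xs : List A) {f g : A → ℕ} → ∑ xs (λ x → f x + g x) ≡ ∑ xs f + ∑ xs g
  ∑-+ []               = refl
  ∑-+ (x ∷ xs) {f} {g} = trans (cong (f x + g x +_) (∑-+ xs)) (lemma (f x) (g x) _ _)
    where
    lemma : ∀ a b c d → a + b + (c + d) ≡ a + c + (b + d)
    lemma = solve-∀

  ∑-swap : {A B : Set} (xs : List A) (ys : List B) {f : A → B → ℕ} →
    ∑ xs (λ x → ∑ ys (f x)) ≡ ∑ ys (λ y → ∑ xs (λ x → f x y))
  ∑-swap []       ys     = sym (trans (∑-const ys 0) (*-zeroʳ (length ys)))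
  ∑-swap (x ∷ xs) ys {f} = trans (cong (∑ ys (f x) +_) (∑-swap xs ys)) (sym (∑-+ ys))

  ∈⇒≤∑ : {A : Set} {xs : List A} {x : A} (f : A → ℕ) → x ∈ˡ xs → f x ≤ ∑ xs f
  ∈⇒≤∑ f (here refl)  = m≤m+n _ _
  ∈⇒≤∑ f (there x∈xs) = m≤n⇒m≤o+n _ (∈⇒≤∑ f x∈xs)

  ∑-cartesianProductWith : {A B C : Set} (g : A → B → C) (xs : List A) (ys : List B) {f : C → ℕ} →
    ∑ (cartesianProductWith g xs ys) f ≡ ∑ xs (λ x → ∑ ys (λ y → f (g x y)))
  ∑-cartesianProductWith g []       ys     = refl
  ∑-cartesianProductWith g (x ∷ xs) ys {f} = begin-equality
    sum (map f (map (g x) ys ++ zs))               ≡⟨ cong sum (map-++ f (map (g x) ys) zs) ⟩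
    sum (map f (map (g x) ys) ++ map f zs)         ≡⟨ sum-++ (map f (map (g x) ys)) (map f zs) ⟩
    sum (map f (map (g x) ys)) + ∑ zs f            ≡⟨ cong₂ _+_ (cong sum (map-∘ ys)) (sym (∑-cartesianProductWith g xs ys)) ⟨
    ∑ ys (λ y → f (g x y)) + ∑ xs (λ x → ∑ ys (λ y → f (g x y))) ∎
    where zs = cartesianProductWith g xs ys

  ∑-filter : {A : Set} {P : Pred A 0ℓ} (P? : Decidable P) (xs : List A) {f : A → ℕ} →
    ∑ (filter P? xs) f ≡ ∑ xs (λ x → 𝟙 (P? x) * f x)
  ∑-filter P? []           = refl
  ∑-filter P? (x ∷ xs) {f} with does (P? x)
  ... | true  = cong₂ _+_ (sym (*-identityˡ (f x))) (∑-filter P? xs)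
  ... | false = ∑-filter P? xs

  length≡∑ : {A : Set} (xs : List A) → length xs ≡ ∑ xs (λ _ → 1)
  length≡∑ xs = sym (trans (∑-const xs 1) (*-identityʳ _))

  𝟙-yes : {P : Set} (P? : Dec P) → P → 𝟙 P? ≡ 1
  𝟙-yes (yes _) p = refl
  𝟙-yes (no ¬p) p = contradiction p ¬p

  𝟙-no : {P : Set} (P? : Dec P) → ¬ P → 𝟙 P? ≡ 0
  𝟙-no (yes p) ¬p = contradiction p ¬p
  𝟙-no (no _)  ¬p = refl

  𝟙-cong : {P Q : Set} (P? : Dec P) (Q? : Dec Q) → (P → Q) → (Q → P) → 𝟙 P? ≡ 𝟙 Q?
  𝟙-cong P? (yes q) _   Q⇒P = 𝟙-yes P? (Q⇒P q)
  𝟙-cong P? (no ¬q) P⇒Q _   = 𝟙-no P? (¬q ∘ P⇒Q)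

  𝟙-≤ : {P : Set} (P? : Dec P) {k : ℕ} → (P → 1 ≤ k) → 𝟙 P? ≤ k
  𝟙-≤ (yes p) 1≤k = 1≤k p
  𝟙-≤ (no ¬p) 1≤k = z≤n

  -- Subsets of given size

  ∑-subsets-suc : ∀ m {f : Subset (suc m) → ℕ} →
    ∑ (subsets (suc m)) f ≡ ∑ (subsets m) (f ∘ (inside Vec.∷_)) + ∑ (subsets m) (f ∘ (outside Vec.∷_))
  ∑-subsets-suc m {f} = trans
    (∑-cartesianProductWith Vec._∷_ (inside ∷ outside ∷ []) (subsets m))
    (cong (∑ (subsets m) (f ∘ (inside Vec.∷_)) +_) (+-identityʳ _))

  ∑-zero : {A : Set} (xs : List A) {f : A → ℕ} → (∀ x → f x ≡ 0) → ∑ xs f ≡ 0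
  ∑-zero xs f≡0 = trans (∑-cong xs f≡0) (trans (∑-const xs 0) (*-zeroʳ (length xs)))

  -- Split on the first element. If it is not in U, the subsets containing it contribute nothing; if
  -- it is, the two halves are the two terms of Pascal's rule. The count gives both the columns
  -- covered by U and, for U = ⊤, all columns.
  ∑-subsets-within : ∀ {m} (U : Subset m) k →
    ∑ (subsets m) (λ p → 𝟙 (∣ p ∣ ≟ k) * 𝟙 (p ⊆? U)) ≡ ∣ U ∣ choose k
  ∑-subsets-within Vec.[] zero    = refl
  ∑-subsets-within Vec.[] (suc k) = refl
  ∑-subsets-within {suc m} (outside Vec.∷ U) k = begin-equality
    ∑ (subsets (suc m)) (λ p → 𝟙 (∣ p ∣ ≟ k) * 𝟙 (p ⊆? outside Vec.∷ U))
      ≡⟨ trans (∑-subsets-suc m) (cong₂ _+_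
           (∑-zero (subsets m) λ p → trans
             (cong (𝟙 (suc ∣ p ∣ ≟ k) *_) (𝟙-no (inside Vec.∷ p ⊆? outside Vec.∷ U) λ p⊆U → contradiction (p⊆U Vec.here) λ ()))
             (*-zeroʳ (𝟙 (suc ∣ p ∣ ≟ k))))
           (∑-cong (subsets m) λ p →
             cong (𝟙 (∣ p ∣ ≟ k) *_) (𝟙-cong (outside Vec.∷ p ⊆? outside Vec.∷ U) (p ⊆? U) drop-∷-⊆ out⊆))) ⟩
    ∑ (subsets m) (λ p → 𝟙 (∣ p ∣ ≟ k) * 𝟙 (p ⊆? U))
      ≡⟨ ∑-subsets-within U k ⟩
    ∣ U ∣ choose k ∎
  ∑-subsets-within {suc m} (inside Vec.∷ U) k = begin-equality
    ∑ (subsets (suc m)) (λ p → 𝟙 (∣ p ∣ ≟ k) * 𝟙 (p ⊆? inside Vec.∷ U))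
      ≡⟨ trans (∑-subsets-suc m) (cong₂ _+_
           (∑-cong (subsets m) λ p →
             cong (𝟙 (suc ∣ p ∣ ≟ k) *_) (𝟙-cong (inside Vec.∷ p ⊆? inside Vec.∷ U) (p ⊆? U) drop-∷-⊆ s⊆s))
           (∑-cong (subsets m) λ p →
             cong (𝟙 (∣ p ∣ ≟ k) *_) (𝟙-cong (outside Vec.∷ p ⊆? inside Vec.∷ U) (p ⊆? U) drop-∷-⊆ out⊆))) ⟩
    ∑ (subsets m) (λ p → 𝟙 (suc ∣ p ∣ ≟ k) * 𝟙 (p ⊆? U)) + ∑ (subsets m) (λ p → 𝟙 (∣ p ∣ ≟ k) * 𝟙 (p ⊆? U))
      ≡⟨ cong₂ _+_ refl (∑-subsets-within U k) ⟩
    ∑ (subsets m) (λ p → 𝟙 (suc ∣ p ∣ ≟ k) * 𝟙 (p ⊆? U)) + ∣ U ∣ choose k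
      ≡⟨ step k ⟩
    suc ∣ U ∣ choose k ∎
    where
    step : ∀ k → ∑ (subsets m) (λ p → 𝟙 (suc ∣ p ∣ ≟ k) * 𝟙 (p ⊆? U)) + ∣ U ∣ choose k ≡ suc ∣ U ∣ choose k
    step zero    = cong (_+ 1) (∑-zero (subsets m) λ p → refl)
    step (suc k) = trans (cong (_+ ∣ U ∣ choose suc k) (trans
      (∑-cong (subsets m) λ p →
        cong (_* 𝟙 (p ⊆? U)) (𝟙-cong (suc ∣ p ∣ ≟ suc k) (∣ p ∣ ≟ k) suc-injective (cong suc)))
      (∑-subsets-within U k))) (nCk+nC[k+1]≡[n+1]C[k+1] ∣ U ∣ k)

  ∑-subsetsOfSize-within : ∀ {m} (U : Subset m) k → ∑ (subsetsOfSize m k) (λ p → 𝟙 (p ⊆? U)) ≡ ∣ U ∣ choose k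
  ∑-subsetsOfSize-within {m} U k = trans (∑-filter (λ p → ∣ p ∣ ≟ k) (subsets m)) (∑-subsets-within U k)

  length-subsetsOfSize : ∀ m k → length (subsetsOfSize m k) ≡ m choose k
  length-subsetsOfSize m k = begin-equality
    length (subsetsOfSize m k)                      ≡⟨ length≡∑ (subsetsOfSize m k) ⟩
    ∑ (subsetsOfSize m k) (λ _ → 1)                 ≡⟨ ∑-cong (subsetsOfSize m k) (λ p → 𝟙-yes (p ⊆? ⊤) ⊆⊤) ⟨
    ∑ (subsetsOfSize m k) (λ p → 𝟙 (p ⊆? ⊤))        ≡⟨ ∑-subsetsOfSize-within (⊤ {m}) k ⟩
    ∣ ⊤ {m} ∣ choose k                              ≡⟨ cong (_choose k) (∣⊤∣≡n m) ⟩
    m choose k                                      ∎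

  choose-monoˡ-≤ : ∀ k {m n} → m ≤ n → m choose k ≤ n choose k
  choose-monoˡ-≤ zero    m≤n       = ≤-refl
  choose-monoˡ-≤ (suc k) z≤n       = z≤n
  choose-monoˡ-≤ (suc k) {suc m} {suc n} (s≤s m≤n)
    rewrite sym (nCk+nC[k+1]≡[n+1]C[k+1] m k) | sym (nCk+nC[k+1]≡[n+1]C[k+1] n k) =
    +-mono-≤ (choose-monoˡ-≤ k m≤n) (choose-monoˡ-≤ (suc k) m≤n)

  choose>0 : ∀ n k → k ≤ n → 0 < n choose k
  choose>0 n       zero    k≤n       = s≤s z≤n
  choose>0 (suc n) (suc k) (s≤s k≤n) rewrite sym (nCk+nC[k+1]≡[n+1]C[k+1] n k) = m≤n⇒m≤n+o _ (choose>0 n k k≤n)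

  subsetsOfSize≢0 : ∀ m k → k ≤ m → NonZero (length (subsetsOfSize m k))
  subsetsOfSize≢0 m k k≤m = subst NonZero (sym (length-subsetsOfSize m k)) (>-nonZero (choose>0 m k k≤m))

  ∈-subsets : ∀ {m} (p : Subset m) → p ∈ˡ subsets m
  ∈-subsets Vec.[]              = here refl
  ∈-subsets (inside  Vec.∷ p) = ∈-cartesianProductWith⁺ Vec._∷_ {xs = inside ∷ outside ∷ []} (here refl) (∈-subsets p)
  ∈-subsets (outside Vec.∷ p) = ∈-cartesianProductWith⁺ Vec._∷_ {xs = inside ∷ outside ∷ []} (there (here refl)) (∈-subsets p)

  ∈-subsetsOfSize : ∀ {m k} (p : Subset m) → ∣ p ∣ ≡ k → p ∈ˡ subsetsOfSize m k
  ∈-subsetsOfSize {k = k} p = ∈-filter⁺ (λ p → ∣ p ∣ ≟ k) (∈-subsets p)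

  ∈-subsetsOfSize⇒size : ∀ {m k} {p : Subset m} → p ∈ˡ subsetsOfSize m k → ∣ p ∣ ≡ k
  ∈-subsetsOfSize⇒size {m} {k} = proj₂ ∘ ∈-filter⁻ (λ p → ∣ p ∣ ≟ k) {xs = subsets m}

  -- Vectors of columns and the event that J is covered by D

  vectors : {A : Set} → List A → ∀ n → List (Vec A n)
  vectors xs zero    = [ Vec.[] ]
  vectors xs (suc n) = cartesianProductWith Vec._∷_ xs (vectors xs n)

  length-vectors : {A : Set} (xs : List A) → ∀ n → length (vectors xs n) ≡ length xs ^ n
  length-vectors xs zero    = refl
  length-vectors xs (suc n) = begin-equality
    length (vectors xs (suc n))                                 ≡⟨ length≡∑ (vectors xs (suc n)) ⟩
    ∑ (vectors xs (suc n)) (λ _ → 1)                            ≡⟨ ∑-cartesianProductWith Vec._∷_ xs (vectors xs n) ⟩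
    ∑ xs (λ _ → ∑ (vectors xs n) (λ _ → 1))                     ≡⟨ ∑-const xs _ ⟩
    length xs * ∑ (vectors xs n) (λ _ → 1)                      ≡⟨ cong (length xs *_) (length≡∑ (vectors xs n)) ⟨
    length xs * length (vectors xs n)                           ≡⟨ cong (length xs *_) (length-vectors xs n) ⟩
    length xs * length xs ^ n                                   ∎

  ∣p∪q∣≤∣p∣+∣q∣ : ∀ {m} (p q : Subset m) → ∣ p ∪ q ∣ ≤ ∣ p ∣ + ∣ q ∣
  ∣p∪q∣≤∣p∣+∣q∣ Vec.[]              Vec.[]              = z≤n
  ∣p∪q∣≤∣p∣+∣q∣ (outside Vec.∷ p) (outside Vec.∷ q) = ∣p∪q∣≤∣p∣+∣q∣ p q
  ∣p∪q∣≤∣p∣+∣q∣ (inside  Vec.∷ p) (outside Vec.∷ q) = s≤s (∣p∪q∣≤∣p∣+∣q∣ p q)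
  ∣p∪q∣≤∣p∣+∣q∣ (outside Vec.∷ p) (inside  Vec.∷ q) =
    ≤-trans (s≤s (∣p∪q∣≤∣p∣+∣q∣ p q)) (≤-reflexive (sym (+-suc ∣ p ∣ ∣ q ∣)))
  ∣p∪q∣≤∣p∣+∣q∣ (inside  Vec.∷ p) (inside  Vec.∷ q) =
    s≤s (≤-trans (∣p∪q∣≤∣p∣+∣q∣ p q) (+-monoʳ-≤ ∣ p ∣ (n≤1+n ∣ q ∣)))

  -- The base `A` makes the induction over columns possible: once a column x of D is fixed, what
  -- remains is the same problem for the tail with base `A ∪ x`. The intended value at the start is
  -- ⊥.
  union : ∀ {m n} → Subset m → Subset n → Vec (Subset m) n → Subset m
  union A Vec.[]              Vec.[]         = A
  union A (outside Vec.∷ D) (x Vec.∷ v) = union A D v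
  union A (inside  Vec.∷ D) (x Vec.∷ v) = union (A ∪ x) D v

  base⊆union : ∀ {m n} (A : Subset m) (D : Subset n) v → A ⊆ union A D v
  base⊆union A Vec.[]              Vec.[]         = id
  base⊆union A (outside Vec.∷ D) (x Vec.∷ v) = base⊆union A D v
  base⊆union A (inside  Vec.∷ D) (x Vec.∷ v) = base⊆union (A ∪ x) D v ∘ p⊆p∪q x

  column⊆union : ∀ {m n} (A : Subset m) (D : Subset n) v {k} → k ∈ D → lookup v k ⊆ union A D v
  column⊆union A (inside  Vec.∷ D) (x Vec.∷ v) Vec.here        = base⊆union (A ∪ x) D v ∘ q⊆p∪q A x
  column⊆union A (outside Vec.∷ D) (x Vec.∷ v) (Vec.there k∈D) = column⊆union A D v k∈D
  column⊆union A (inside  Vec.∷ D) (x Vec.∷ v) (Vec.there k∈D) = column⊆union (A ∪ x) D v k∈D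

  ∣union∣≤ : ∀ {m n} (A : Subset m) (D : Subset n) {L w} → (∀ {x} → x ∈ˡ L → ∣ x ∣ ≤ w) →
    ∀ {v} → v ∈ˡ vectors L n → ∣ union A D v ∣ ≤ ∣ A ∣ + ∣ D ∣ * w
  ∣union∣≤ A Vec.[] ∣L∣≤w (here refl) = m≤m+n _ _
  ∣union∣≤ {n = suc n} A (s Vec.∷ D) {L} ∣L∣≤w v∈
    with ∈-cartesianProductWith⁻ Vec._∷_ L (vectors L n) v∈
  ∣union∣≤ A (outside Vec.∷ D) ∣L∣≤w v∈ | _ , _ , _ , v∈′ , refl = ∣union∣≤ A D ∣L∣≤w v∈′
  ∣union∣≤ A (inside Vec.∷ D) {w = w} ∣L∣≤w v∈ | x , v , x∈ , v∈′ , refl = begin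
    ∣ union (A ∪ x) D v ∣         ≤⟨ ∣union∣≤ (A ∪ x) D ∣L∣≤w v∈′ ⟩
    ∣ A ∪ x ∣ + ∣ D ∣ * w         ≤⟨ +-monoˡ-≤ _ (∣p∪q∣≤∣p∣+∣q∣ A x) ⟩
    ∣ A ∣ + ∣ x ∣ + ∣ D ∣ * w     ≤⟨ +-monoˡ-≤ _ (+-monoʳ-≤ ∣ A ∣ (∣L∣≤w x∈)) ⟩
    ∣ A ∣ + w + ∣ D ∣ * w         ≡⟨ +-assoc ∣ A ∣ w _ ⟩
    ∣ A ∣ + (w + ∣ D ∣ * w)       ∎

  -- 1 if J is disjoint from D and every column of v in J is contained in the
  -- union of A and the columns of v in D, else 0.

  covered : ∀ {m n} → Subset m → Subset n → Subset n → Vec (Subset m) n → ℕ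
  covered A Vec.[]              Vec.[]              Vec.[]         = 1
  covered A (outside Vec.∷ D) (outside Vec.∷ J) (x Vec.∷ v) = covered A D J v
  covered A (inside  Vec.∷ D) (outside Vec.∷ J) (x Vec.∷ v) = covered (A ∪ x) D J v
  covered A (outside Vec.∷ D) (inside  Vec.∷ J) (x Vec.∷ v) = covered A D J v * 𝟙 (x ⊆? union A D v)
  covered A (inside  Vec.∷ D) (inside  Vec.∷ J) (x Vec.∷ v) = 0

  covered≡1 : ∀ {m n} (A : Subset m) (D J : Subset n) v →
    (∀ {j} → j ∈ J → j ∉ D × lookup v j ⊆ union A D v) → covered A D J v ≡ 1
  covered≡1 A Vec.[]              Vec.[]              Vec.[]         hyp = refl
  covered≡1 A (outside Vec.∷ D) (outside Vec.∷ J) (x Vec.∷ v) hyp =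
    covered≡1 A D J v λ j∈J → let j∉D , v⊆ = hyp (Vec.there j∈J) in j∉D ∘ Vec.there , v⊆
  covered≡1 A (inside  Vec.∷ D) (outside Vec.∷ J) (x Vec.∷ v) hyp =
    covered≡1 (A ∪ x) D J v λ j∈J → let j∉D , v⊆ = hyp (Vec.there j∈J) in j∉D ∘ Vec.there , v⊆
  covered≡1 A (outside Vec.∷ D) (inside  Vec.∷ J) (x Vec.∷ v) hyp = cong₂ _*_
    (covered≡1 A D J v λ j∈J → let j∉D , v⊆ = hyp (Vec.there j∈J) in j∉D ∘ Vec.there , v⊆)
    (𝟙-yes (x ⊆? union A D v) (proj₂ (hyp Vec.here)))
  covered≡1 A (inside  Vec.∷ D) (inside  Vec.∷ J) (x Vec.∷ v) hyp =
    contradiction Vec.here (proj₁ (hyp Vec.here))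

  -- The columns in J are independent of the union of the columns in D, and
  -- each of them lies in that union for at most c of the choices in L.

  ∑-covered : ∀ {m n} (A : Subset m) (D J : Subset n) (L : List (Subset m)) {t w c} →
    (∀ {x} → x ∈ˡ L → ∣ x ∣ ≤ w) →
    (∀ U → ∣ U ∣ ≤ t → ∑ L (λ x → 𝟙 (x ⊆? U)) ≤ c) →
    ∣ A ∣ + ∣ D ∣ * w ≤ t →
    length L ^ ∣ J ∣ * ∑ (vectors L n) (covered A D J) ≤ c ^ ∣ J ∣ * length L ^ n
  ∑-covered A Vec.[] Vec.[] L ∣L∣≤w within≤c ≤t = ≤-refl
  ∑-covered {n = suc n} A (outside Vec.∷ D) (outside Vec.∷ J) L {c = c} ∣L∣≤w within≤c ≤t = begin
    N ^ ∣ J ∣ * ∑ (vectors L (suc n)) (covered A (outside Vec.∷ D) (outside Vec.∷ J))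
      ≡⟨ cong (N ^ ∣ J ∣ *_) (trans (∑-cartesianProductWith Vec._∷_ L (vectors L n)) (∑-const L _)) ⟩
    N ^ ∣ J ∣ * (N * ∑ (vectors L n) (covered A D J))
      ≡⟨ lemma (N ^ ∣ J ∣) N _ ⟩
    N * (N ^ ∣ J ∣ * ∑ (vectors L n) (covered A D J))
      ≤⟨ *-monoʳ-≤ N (∑-covered A D J L ∣L∣≤w within≤c ≤t) ⟩
    N * (c ^ ∣ J ∣ * N ^ n)
      ≡⟨ lemma N (c ^ ∣ J ∣) _ ⟩
    c ^ ∣ J ∣ * (N * N ^ n) ∎
    where
    N = length L
    lemma : ∀ a b c → a * (b * c) ≡ b * (a * c)
    lemma = solve-∀
  -- The column x joins the base, which grows by at most w, while the share reserved for the rest of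
  -- D shrinks by w; the bound t persists.
  ∑-covered {n = suc n} A (inside Vec.∷ D) (outside Vec.∷ J) L {t} {w} {c} ∣L∣≤w within≤c ≤t = begin
    N ^ ∣ J ∣ * ∑ (vectors L (suc n)) (covered A (inside Vec.∷ D) (outside Vec.∷ J))
      ≡⟨ cong (N ^ ∣ J ∣ *_) (∑-cartesianProductWith Vec._∷_ L (vectors L n)) ⟩
    N ^ ∣ J ∣ * ∑ L (λ x → ∑ (vectors L n) (covered (A ∪ x) D J))
      ≡⟨ ∑-*ˡ L (N ^ ∣ J ∣) ⟨
    ∑ L (λ x → N ^ ∣ J ∣ * ∑ (vectors L n) (covered (A ∪ x) D J))
      ≤⟨ ∑-mono L (λ {x} x∈L → ∑-covered (A ∪ x) D J L ∣L∣≤w within≤c (bound x x∈L)) ⟩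
    ∑ L (λ _ → c ^ ∣ J ∣ * N ^ n)
      ≡⟨ ∑-const L _ ⟩
    N * (c ^ ∣ J ∣ * N ^ n)
      ≡⟨ lemma N (c ^ ∣ J ∣) _ ⟩
    c ^ ∣ J ∣ * (N * N ^ n) ∎
    where
    N = length L
    lemma : ∀ a b c → a * (b * c) ≡ b * (a * c)
    lemma = solve-∀
    bound : ∀ x → x ∈ˡ L → ∣ A ∪ x ∣ + ∣ D ∣ * w ≤ t
    bound x x∈L = begin
      ∣ A ∪ x ∣ + ∣ D ∣ * w        ≤⟨ +-monoˡ-≤ _ (≤-trans (∣p∪q∣≤∣p∣+∣q∣ A x) (+-monoʳ-≤ ∣ A ∣ (∣L∣≤w x∈L))) ⟩
      ∣ A ∣ + w + ∣ D ∣ * w        ≡⟨ +-assoc ∣ A ∣ w _ ⟩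
      ∣ A ∣ + (w + ∣ D ∣ * w)      ≤⟨ ≤t ⟩
      t                            ∎
  -- The first column x is not in D, so the union depends only on the remaining columns v.
  -- Exchanging the sums fixes v, and then at most c choices of x lie inside the union.
  ∑-covered {n = suc n} A (outside Vec.∷ D) (inside Vec.∷ J) L {t} {w} {c} ∣L∣≤w within≤c ≤t = begin
    N * N ^ ∣ J ∣ * ∑ (vectors L (suc n)) (covered A (outside Vec.∷ D) (inside Vec.∷ J))
      ≡⟨ cong (N * N ^ ∣ J ∣ *_) (trans (∑-cartesianProductWith Vec._∷_ L (vectors L n)) (∑-swap L (vectors L n))) ⟩
    N * N ^ ∣ J ∣ * ∑ (vectors L n) (λ v → ∑ L (λ x → covered A D J v * 𝟙 (x ⊆? union A D v)))
      ≡⟨ cong (N * N ^ ∣ J ∣ *_) (∑-cong (vectors L n) (λ v → ∑-*ˡ L (covered A D J v))) ⟩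
    N * N ^ ∣ J ∣ * ∑ (vectors L n) (λ v → covered A D J v * ∑ L (λ x → 𝟙 (x ⊆? union A D v)))
      ≤⟨ *-monoʳ-≤ (N * N ^ ∣ J ∣) (∑-mono (vectors L n) λ {v} v∈ →
           ≤-trans (*-monoʳ-≤ (covered A D J v) (within≤c (union A D v) (≤-trans (∣union∣≤ A D ∣L∣≤w v∈) ≤t)))
                   (≤-reflexive (*-comm (covered A D J v) c))) ⟩
    N * N ^ ∣ J ∣ * ∑ (vectors L n) (λ v → c * covered A D J v)
      ≡⟨ cong (N * N ^ ∣ J ∣ *_) (∑-*ˡ (vectors L n) c) ⟩
    N * N ^ ∣ J ∣ * (c * ∑ (vectors L n) (covered A D J))
      ≡⟨ lemma N (N ^ ∣ J ∣) c _ ⟩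
    N * c * (N ^ ∣ J ∣ * ∑ (vectors L n) (covered A D J))
      ≤⟨ *-monoʳ-≤ (N * c) (∑-covered A D J L ∣L∣≤w within≤c ≤t) ⟩
    N * c * (c ^ ∣ J ∣ * N ^ n)
      ≡⟨ lemma′ N c (c ^ ∣ J ∣) _ ⟩
    c * c ^ ∣ J ∣ * (N * N ^ n) ∎
    where
    N = length L
    lemma : ∀ a b c d → a * b * (c * d) ≡ a * c * (b * d)
    lemma = solve-∀
    lemma′ : ∀ a b c d → a * b * (c * d) ≡ b * c * (a * d)
    lemma′ = solve-∀
  ∑-covered {n = suc n} A (inside Vec.∷ D) (inside Vec.∷ J) L {c = c} ∣L∣≤w within≤c ≤t = begin
    N * N ^ ∣ J ∣ * ∑ (vectors L (suc n)) (covered A (inside Vec.∷ D) (inside Vec.∷ J))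
      ≡⟨ cong (N * N ^ ∣ J ∣ *_) (trans (∑-cartesianProductWith Vec._∷_ L (vectors L n))
           (∑-zero L λ _ → ∑-zero (vectors L n) λ _ → refl)) ⟩
    N * N ^ ∣ J ∣ * 0
      ≡⟨ *-zeroʳ (N * N ^ ∣ J ∣) ⟩
    0
      ≤⟨ z≤n ⟩
    c * c ^ ∣ J ∣ * (N * N ^ n) ∎
    where N = length L

  -- The union bound over pairs of column sets

  subset-of-filter : ∀ {A : Set} {P : Pred A 0ℓ} (P? : Decidable P) {n} (f : Fin n → A) d →
    d ≤ length (filter P? (tabulate f)) → ∃[ J ] ∣ J ∣ ≡ d × (∀ {j} → j ∈ J → P (f j))
  subset-of-filter P? {zero}  f zero d≤ = Vec.[] , refl , λ ()
  subset-of-filter P? {suc n} f d d≤ with P? (f zero)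
  subset-of-filter P? {suc n} f d d≤ | no _ =
    let J , ∣J∣ , J⊆ = subset-of-filter P? (f ∘ suc) d d≤
    in outside Vec.∷ J , ∣J∣ , λ { (Vec.there j∈J) → J⊆ j∈J }
  -- Enough elements are found; any further ones are dropped, so that J has exactly d elements.
  subset-of-filter P? {suc n} f zero d≤ | yes _ =
    ⊥ , ∣⊥∣≡0 (suc n) , λ j∈⊥ → contradiction j∈⊥ ∉⊥
  subset-of-filter P? {suc n} f (suc d) (s≤s d≤) | yes p =
    let J , ∣J∣ , J⊆ = subset-of-filter P? (f ∘ suc) d d≤
    in inside Vec.∷ J , cong suc ∣J∣ , λ { Vec.here → p ; (Vec.there j∈J) → J⊆ j∈J }

  ¬distinguishable⇒⊆union : ∀ {m n} (v : Vec (Subset m) n) D j →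
    ¬ Distinguishable (fromColumns v) D j → lookup v j ⊆ union ⊥ D v
  ¬distinguishable⇒⊆union v D j ¬dist {i} i∈vj with i ∈? union ⊥ D v
  ... | yes i∈U = i∈U
  ... | no  i∉U = contradiction (i , []=⇒lookup i∈vj , row-zero) ¬dist
    where
    row-zero : ∀ k → k ∈ D → lookup (lookup v k) i ≡ false
    row-zero k k∈D with lookup (lookup v k) i in eq
    ... | false = refl
    ... | true  = contradiction (column⊆union ⊥ D v k∈D (lookup⇒[]= i (lookup v k) eq)) i∉U

  -- The union bound at a single outcome. The inequality is decided and its failure shown to force
  -- resolvability, so no D has to be extracted from a negated universal statement.
  ¬resolvable⇒covered : ∀ {m n} d (v : Vec (Subset m) n) → ¬ Resolvable (fromColumns v) d d →
    1 ≤ ∑ (subsetsOfSize n d) (λ D → ∑ (subsetsOfSize n d) (λ J → covered ⊥ D J v))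
  ¬resolvable⇒covered {n = n} d v ¬res with 1 ≤? ∑ (subsetsOfSize n d) (λ D → ∑ (subsetsOfSize n d) (λ J → covered ⊥ D J v))
  ... | yes 1≤ = 1≤
  ... | no  1≰ = contradiction res ¬res
    where
    res : Resolvable (fromColumns v) d d
    res D ∣D∣≡d with length (indistinguishable (fromColumns v) D) <? d
    ... | yes lt = lt
    ... | no ≮d =
      let J , ∣J∣≡d , indist = subset-of-filter _ id d (≮⇒≥ ≮d)
      in contradiction (begin
        1
          ≡⟨ covered≡1 ⊥ D J v (map₂ (¬distinguishable⇒⊆union v D _) ∘ indist) ⟨
        covered ⊥ D J v
          ≤⟨ ∈⇒≤∑ (λ J → covered ⊥ D J v) (∈-subsetsOfSize J ∣J∣≡d) ⟩
        ∑ (subsetsOfSize n d) (λ J → covered ⊥ D J v)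
          ≤⟨ ∈⇒≤∑ (λ D → ∑ (subsetsOfSize n d) (λ J → covered ⊥ D J v)) (∈-subsetsOfSize D ∣D∣≡d) ⟩
        ∑ (subsetsOfSize n d) (λ D → ∑ (subsetsOfSize n d) (λ J → covered ⊥ D J v)) ∎) 1≰

  -- The factor N^d, cancelled in the proof, clears the denominators of the d factors c/N ≤ 2^(-w),
  -- one for each column of J. Writing `w * d` for t keeps division out of the count.
  unresolvable-count : ∀ n d w .{{_ : NonZero d}} →
    let L = subsetsOfSize (2 * (w * d)) w
        C = n choose d
    in 2 ^ (w * d) * ∑ (vectors L n) (λ v → 𝟙 (¬? (resolvable? d d (fromColumns v)))) ≤ C * C * length L ^ n
  unresolvable-count n d w = *-cancelˡ-≤ (N ^ d) (begin
    N ^ d * (2 ^ t * bad)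
      ≡⟨ lemma₁ (N ^ d) (2 ^ t) bad ⟩
    2 ^ t * (N ^ d * bad)
      ≤⟨ *-monoʳ-≤ (2 ^ t) (*-monoʳ-≤ (N ^ d) union-bound) ⟩
    2 ^ t * (N ^ d * ∑ S (λ D → ∑ S (λ J → ∑ V (covered ⊥ D J))))
      ≡⟨ cong (2 ^ t *_) (trans (∑-cong S (λ D → ∑-*ˡ S (N ^ d))) (∑-*ˡ S (N ^ d))) ⟨
    2 ^ t * ∑ S (λ D → ∑ S (λ J → N ^ d * ∑ V (covered ⊥ D J)))
      ≤⟨ *-monoʳ-≤ (2 ^ t) (∑-mono S λ {D} D∈S → ∑-mono S λ {J} J∈S → pair-bound D J D∈S J∈S) ⟩
    2 ^ t * ∑ S (λ D → ∑ S (λ J → c ^ d * N ^ n))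
      ≡⟨ cong (2 ^ t *_) (trans (∑-const S _) (cong (length S *_) (∑-const S _))) ⟩
    2 ^ t * (length S * (length S * (c ^ d * N ^ n)))
      ≡⟨ cong (λ x → 2 ^ t * (x * (x * (c ^ d * N ^ n)))) (length-subsetsOfSize n d) ⟩
    2 ^ t * (C * (C * (c ^ d * N ^ n)))
      ≡⟨ lemma₂ (2 ^ t) C (c ^ d) (N ^ n) ⟩
    2 ^ t * c ^ d * (C * C * N ^ n)
      ≤⟨ *-monoˡ-≤ (C * C * N ^ n) 2^t*c^d≤N^d ⟩
    N ^ d * (C * C * N ^ n) ∎)
    where
    t = w * d
    L = subsetsOfSize (2 * t) w
    N = length L
    C = n choose d
    c = t choose w
    S = subsetsOfSize n d
    V = vectors L n
    bad = ∑ V (λ v → 𝟙 (¬? (resolvable? d d (fromColumns v))))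
    lemma₁ : ∀ a b c → a * (b * c) ≡ b * (a * c)
    lemma₁ = solve-∀
    lemma₂ : ∀ a b c d → a * (b * (b * (c * d))) ≡ a * c * (b * b * d)
    lemma₂ = solve-∀
    2^t*c^d≤N^d : 2 ^ t * c ^ d ≤ N ^ d
    2^t*c^d≤N^d = begin
      2 ^ t * c ^ d            ≡⟨ cong (_* c ^ d) (^-*-assoc 2 w d) ⟨
      (2 ^ w) ^ d * c ^ d      ≡⟨ ^-distribʳ-* (2 ^ w) c d ⟨
      (2 ^ w * c) ^ d          ≤⟨ ^-monoˡ-≤ d (choose-double t w) ⟩
      ((2 * t) choose w) ^ d   ≡⟨ cong (_^ d) (length-subsetsOfSize (2 * t) w) ⟨
      N ^ d                    ∎
    instance
      N^d≢0 : NonZero (N ^ d)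
      N^d≢0 = m^n≢0 N d {{subsetsOfSize≢0 (2 * t) w (≤-trans (m≤m*n w d) (m≤n*m t 2))}}
    pair-bound : ∀ D J → D ∈ˡ S → J ∈ˡ S → N ^ d * ∑ V (covered ⊥ D J) ≤ c ^ d * N ^ n
    pair-bound D J D∈S J∈S = subst (λ k → N ^ k * ∑ V (covered ⊥ D J) ≤ c ^ k * N ^ n) (∈-subsetsOfSize⇒size J∈S)
      (∑-covered ⊥ D J L {t} {w} (≤-reflexive ∘ ∈-subsetsOfSize⇒size)
        (λ U ∣U∣≤t → ≤-trans (≤-reflexive (∑-subsetsOfSize-within U w)) (choose-monoˡ-≤ w ∣U∣≤t))
        (≤-reflexive (trans (cong₂ (λ x y → x + y * w) (∣⊥∣≡0 (2 * t)) (∈-subsetsOfSize⇒size D∈S)) (*-comm d w))))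
    union-bound : bad ≤ ∑ S (λ D → ∑ S (λ J → ∑ V (covered ⊥ D J)))
    union-bound = begin
      bad                                                   ≤⟨ ∑-mono V (λ {v} _ → term v) ⟩
      ∑ V (λ v → ∑ S (λ D → ∑ S (λ J → covered ⊥ D J v)))   ≡⟨ ∑-swap V S ⟩
      ∑ S (λ D → ∑ V (λ v → ∑ S (λ J → covered ⊥ D J v)))   ≡⟨ ∑-cong S (λ D → ∑-swap V S) ⟩
      ∑ S (λ D → ∑ S (λ J → ∑ V (covered ⊥ D J)))           ∎
      where
      term : (v : Vec (Subset (2 * t)) n) → 𝟙 (¬? (resolvable? d d (fromColumns v))) ≤ ∑ S (λ D → ∑ S (λ J → covered ⊥ D J v))
      term v = 𝟙-≤ (¬? (resolvable? d d (fromColumns v))) (¬resolvable⇒covered d v)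

-- Rational probabilities and Dedekind cuts

import Algebra.Properties.CommutativeSemiring.Exp as Exp
import Data.Integer.Base as ℤ
import Data.Integer.Properties as ℤ
import Data.Nat.Base as ℕ
import Data.Nat.DivMod as ℕ
import Data.Nat.GCD as ℕ
import Data.Nat.Properties as ℕ
import Data.Rational.Base as ℚ
import Data.Rational.Properties as ℚ
import Data.Rational.Unnormalised.Base as ℚᵘ
import Data.Rational.Unnormalised.Properties as ℚᵘ
open import Algebra.Definitions.RawSemiring ℚ.+-*-rawSemiring using (_^_)
open import Data.Integer.Base using (+_)
open import Data.Rational.Base using (ℚ; 1ℚ; _/_; _+_; _-_; _*_; _≤_; Positive; ↥_; ↧ₙ_; toℚᵘ)
open import Data.Rational.Solver using (module +-*-Solver)
open Exp (CommutativeRing.commutativeSemiring ℚ.+-*-commutativeRing) using (^-distrib-*)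
open +-*-Solver

-- Natural numbers inside ℚ

ι : ℕ → ℚ
ι n = + n / 1

-- Identities between reduced fractions are checked on unnormalised ones, where no gcd occurs and
-- they become identities in ℤ.
toℚᵘ-ι : ∀ n → toℚᵘ (ι n) ℚᵘ.≃ ℚᵘ.mkℚᵘ (+ n) 0
toℚᵘ-ι n = ℚ.toℚᵘ-fromℚᵘ (ℚᵘ.mkℚᵘ (+ n) 0)

ι-+ : ∀ m n → ι (m ℕ.+ n) ≡ ι m + ι n
ι-+ m n = ℚ.toℚᵘ-injective (begin
  toℚᵘ (ι (m ℕ.+ n))                         ≈⟨ toℚᵘ-ι (m ℕ.+ n) ⟩
  ℚᵘ.mkℚᵘ (+ (m ℕ.+ n)) 0                    ≈⟨ ℚᵘ.*≡* (cong (ℤ._* ℤ.1ℤ) (cong₂ ℤ._+_ (sym (ℤ.*-identityʳ (+ m))) (sym (ℤ.*-identityʳ (+ n))))) ⟩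
  ℚᵘ.mkℚᵘ (+ m) 0 ℚᵘ.+ ℚᵘ.mkℚᵘ (+ n) 0       ≈⟨ ℚᵘ.+-cong (toℚᵘ-ι m) (toℚᵘ-ι n) ⟨
  toℚᵘ (ι m) ℚᵘ.+ toℚᵘ (ι n)                 ≈⟨ ℚ.toℚᵘ-homo-+ (ι m) (ι n) ⟨
  toℚᵘ (ι m + ι n)                           ∎)
  where open ℚᵘ.≃-Reasoning

ι-* : ∀ m n → ι (m ℕ.* n) ≡ ι m * ι n
ι-* m n = ℚ.toℚᵘ-injective (begin
  toℚᵘ (ι (m ℕ.* n))                         ≈⟨ toℚᵘ-ι (m ℕ.* n) ⟩
  ℚᵘ.mkℚᵘ (+ (m ℕ.* n)) 0                    ≈⟨ ℚᵘ.*≡* (cong (ℤ._* ℤ.1ℤ) (ℤ.pos-* m n)) ⟩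
  ℚᵘ.mkℚᵘ (+ m) 0 ℚᵘ.* ℚᵘ.mkℚᵘ (+ n) 0       ≈⟨ ℚᵘ.*-cong (toℚᵘ-ι m) (toℚᵘ-ι n) ⟨
  toℚᵘ (ι m) ℚᵘ.* toℚᵘ (ι n)                 ≈⟨ ℚ.toℚᵘ-homo-* (ι m) (ι n) ⟨
  toℚᵘ (ι m * ι n)                           ∎)
  where open ℚᵘ.≃-Reasoning

ι-^ : ∀ m k → ι (m ℕ.^ k) ≡ ι m ^ k
ι-^ m zero    = refl
ι-^ m (suc k) = trans (ι-* m (m ℕ.^ k)) (cong (ι m *_) (ι-^ m k))

ι-mono-≤ : ∀ {m n} → m ℕ.≤ n → ι m ≤ ι n
ι-mono-≤ {m} {n} m≤n = ℚ.toℚᵘ-cancel-≤ (begin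
  toℚᵘ (ι m)         ≃⟨ toℚᵘ-ι m ⟩
  ℚᵘ.mkℚᵘ (+ m) 0    ≤⟨ ℚᵘ.*≤* (ℤ.*-monoʳ-≤-nonNeg (+ 1) (ℤ.+≤+ m≤n)) ⟩
  ℚᵘ.mkℚᵘ (+ n) 0    ≃⟨ toℚᵘ-ι n ⟨
  toℚᵘ (ι n)         ∎)
  where open ℚᵘ.≤-Reasoning

ι-mono-< : ∀ {m n} → m < n → ι m ℚ.< ι n
ι-mono-< {m} {n} m<n = ℚ.toℚᵘ-cancel-< (begin-strict
  toℚᵘ (ι m)         ≃⟨ toℚᵘ-ι m ⟩
  ℚᵘ.mkℚᵘ (+ m) 0    <⟨ ℚᵘ.*<* (ℤ.*-monoʳ-<-pos (+ 1) (ℤ.+<+ m<n)) ⟩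
  ℚᵘ.mkℚᵘ (+ n) 0    ≃⟨ toℚᵘ-ι n ⟨
  toℚᵘ (ι n)         ∎)
  where open ℚᵘ.≤-Reasoning

ι-cancel-< : ∀ {m n} → ι m ℚ.< ι n → m < n
ι-cancel-< {m} {n} ιm<ιn with m ℕ.<? n
... | yes m<n = m<n
... | no  m≮n = contradiction (ℚ.<-≤-trans ιm<ιn (ι-mono-≤ (ℕ.≮⇒≥ m≮n))) (ℚ.<-irrefl refl)

ι-pos : ∀ n .{{_ : NonZero n}} → Positive (ι n)
ι-pos n = ℚ.normalize-pos n 1

/-*-cancel : ∀ m n .{{_ : NonZero n}} → (+ m / n) * ι n ≡ ι m
/-*-cancel m n@(suc n-1) = ℚ.toℚᵘ-injective (begin
  toℚᵘ ((+ m / n) * ι n)                          ≈⟨ ℚ.toℚᵘ-homo-* (+ m / n) (ι n) ⟩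
  toℚᵘ (+ m / n) ℚᵘ.* toℚᵘ (ι n)                  ≈⟨ ℚᵘ.*-cong (ℚ.toℚᵘ-fromℚᵘ (ℚᵘ.mkℚᵘ (+ m) n-1)) (toℚᵘ-ι n) ⟩
  ℚᵘ.mkℚᵘ (+ m) n-1 ℚᵘ.* ℚᵘ.mkℚᵘ (+ n) 0          ≈⟨ ℚᵘ.*≡* (trans (ℤ.*-identityʳ (+ m ℤ.* + n)) (cong (λ k → + m ℤ.* + k) (sym (ℕ.*-identityʳ n)))) ⟩
  ℚᵘ.mkℚᵘ (+ m) 0                                 ≈⟨ toℚᵘ-ι m ⟨
  toℚᵘ (ι m)                                      ∎)
  where open ℚᵘ.≃-Reasoning

*-cancelʳ-≡-pos : ∀ r .{{_ : Positive r}} {p q} → p * r ≡ q * r → p ≡ q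
*-cancelʳ-≡-pos r pr≡qr = ℚ.≤-antisym
  (ℚ.*-cancelʳ-≤-pos r (ℚ.≤-reflexive pr≡qr))
  (ℚ.*-cancelʳ-≤-pos r (ℚ.≤-reflexive (sym pr≡qr)))

-- The exponents ↥ q and ↧ₙ q in the definition of log₂ are those of the
-- reduced fraction.

log₂-reduced : ∀ a b .{{_ : NonZero b}} → ∃[ a′ ] ∃[ g ]
  ↥ (+ a / b) ≡ + a′ × a ≡ a′ ℕ.* g × b ≡ ↧ₙ (+ a / b) ℕ.* g
log₂-reduced a b = a ℕ./ g , g , ↥≡ , ℤ.+-injective num , ℤ.+-injective den
  where
  g = ℕ.gcd a b
  instance _ = ℕ.≢-nonZero (ℕ.gcd[m,n]≢0 a b (inj₂ (ℕ.≢-nonZero⁻¹ b)))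
  instance _ = ℕ.≢-nonZero (ℕ.n/gcd[m,n]≢0 a b)
  ↥≡ : ↥ (+ a / b) ≡ + (a ℕ./ g)
  ↥≡ = ℚ.↥-mkℚ+ (a ℕ./ g) (b ℕ./ g)
  num : + a ≡ + (a ℕ./ g ℕ.* g)
  num = trans (sym (ℚ.↥-/ (+ a) b)) (trans (cong (ℤ._* + g) ↥≡) (sym (ℤ.pos-* (a ℕ./ g) g)))
  den : + b ≡ + (↧ₙ (+ a / b) ℕ.* g)
  den = trans (sym (ℚ.↧-/ (+ a) b)) (sym (ℤ.pos-* (↧ₙ (+ a / b)) g))

-- With g = gcd a b, both sides of the given inequality are g-th powers. Extracting the root leaves
-- the inequality for the exponents of the reduced fraction, which is the one that `log₂` asks for.
log₂-intro : ∀ (x : Real) {p q} .{{_ : NonZero p}} .{{_ : NonZero q}} a b .{{_ : NonZero b}} →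
  x (+ p / q) → 2 ℕ.^ a ℕ.* q ℕ.^ b ℕ.≤ p ℕ.^ b → log₂ x (+ a / b)
log₂-intro x {p} {q} a b xp/q le with log₂-reduced a b
... | a′ , g , ↥≡ , a≡ , b≡ = r , ℚ.positive⁻¹ r , xp/q , 2^≤r^
  where
  r = + p / q
  b′ = ↧ₙ (+ a / b)
  instance
    r-pos : Positive r
    r-pos = ℚ.normalize-pos p q
    g≢0 : NonZero g
    g≢0 = ℕ.≢-nonZero λ g≡0 → ℕ.≢-nonZero⁻¹ b (trans b≡ (trans (cong (b′ ℕ.*_) g≡0) (ℕ.*-zeroʳ b′)))
    q^b′-pos : Positive (ι (q ℕ.^ b′))
    q^b′-pos = ι-pos (q ℕ.^ b′) {{ℕ.m^n≢0 q b′}}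
  le^g : (2 ℕ.^ a′ ℕ.* q ℕ.^ b′) ℕ.^ g ℕ.≤ (p ℕ.^ b′) ℕ.^ g
  le^g = begin
    (2 ℕ.^ a′ ℕ.* q ℕ.^ b′) ℕ.^ g            ≡⟨ ^-distribʳ-* (2 ℕ.^ a′) (q ℕ.^ b′) g ⟩
    (2 ℕ.^ a′) ℕ.^ g ℕ.* (q ℕ.^ b′) ℕ.^ g    ≡⟨ cong₂ ℕ._*_ (ℕ.^-*-assoc 2 a′ g) (ℕ.^-*-assoc q b′ g) ⟩
    2 ℕ.^ (a′ ℕ.* g) ℕ.* q ℕ.^ (b′ ℕ.* g)    ≡⟨ cong₂ (λ i j → 2 ℕ.^ i ℕ.* q ℕ.^ j) a≡ b≡ ⟨
    2 ℕ.^ a ℕ.* q ℕ.^ b                      ≤⟨ le ⟩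
    p ℕ.^ b                                  ≡⟨ cong (p ℕ.^_) b≡ ⟩
    p ℕ.^ (b′ ℕ.* g)                         ≡⟨ ℕ.^-*-assoc p b′ g ⟨
    (p ℕ.^ b′) ℕ.^ g                         ∎
    where open ℕ.≤-Reasoning
  le′ : 2 ℕ.^ a′ ℕ.* q ℕ.^ b′ ℕ.≤ p ℕ.^ b′
  le′ = ℕ.≮⇒≥ λ lt → ℕ.<⇒≱ (ℕ.^-monoˡ-< g lt) le^g
  2^≤r^ : 2^ (↥ (+ a / b)) ≤ r ^ b′
  2^≤r^ = subst (λ i → 2^ i ≤ r ^ b′) (sym ↥≡) (ℚ.*-cancelʳ-≤-pos (ι (q ℕ.^ b′)) (begin
    ι 2 ^ a′ * ι (q ℕ.^ b′)       ≡⟨ cong (_* ι (q ℕ.^ b′)) (ι-^ 2 a′) ⟨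
    ι (2 ℕ.^ a′) * ι (q ℕ.^ b′)   ≡⟨ ι-* (2 ℕ.^ a′) (q ℕ.^ b′) ⟨
    ι (2 ℕ.^ a′ ℕ.* q ℕ.^ b′)     ≤⟨ ι-mono-≤ le′ ⟩
    ι (p ℕ.^ b′)                  ≡⟨ ι-^ p b′ ⟩
    ι p ^ b′                      ≡⟨ cong (_^ b′) (/-*-cancel p q) ⟨
    (r * ι q) ^ b′                ≡⟨ ^-distrib-* r (ι q) b′ ⟩
    r ^ b′ * ι q ^ b′             ≡⟨ cong (r ^ b′ *_) (ι-^ q b′) ⟨
    r ^ b′ * ι (q ℕ.^ b′)         ∎))
    where open ℚ.≤-Reasoning

fromℕ-intro : ∀ n {p q} .{{_ : NonZero q}} → p < n ℕ.* q → fromℕ n (+ p / q)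
fromℕ-intro n {p} {q} p<nq = ℚ.*-cancelʳ-<-nonNeg (ι q) {{ℚ.pos⇒nonNeg (ι q) {{ι-pos q}}}} (begin-strict
  (+ p / q) * ι q    ≡⟨ /-*-cancel p q ⟩
  ι p                <⟨ ι-mono-< p<nq ⟩
  ι (n ℕ.* q)        ≡⟨ ι-* n q ⟩
  ι n * ι q          ∎)
  where open ℚ.≤-Reasoning

-- Partial sums of e and the use of the real hypothesis

sumℚ-∷ʳ : ∀ xs x → sumℚ (xs ∷ʳ x) ≡ sumℚ xs + x
sumℚ-∷ʳ []       x = trans (ℚ.+-identityʳ x) (sym (ℚ.+-identityˡ x))
sumℚ-∷ʳ (y ∷ xs) x = trans (cong (λ z → y + z) (sumℚ-∷ʳ xs x)) (sym (ℚ.+-assoc y (sumℚ xs) x))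

e-partial-suc : ∀ m → sumℚ (map 1/_! (upTo (suc m))) ≡ sumℚ (map 1/_! (upTo m)) + 1/ m !
e-partial-suc m = begin
  sumℚ (map 1/_! (upTo (suc m)))            ≡⟨ cong (sumℚ ∘ map 1/_!) (upTo-∷ʳ m) ⟨
  sumℚ (map 1/_! (upTo m ∷ʳ m))             ≡⟨ cong sumℚ (map-++ 1/_! (upTo m) [ m ]) ⟩
  sumℚ (map 1/_! (upTo m) ∷ʳ 1/ m !)        ≡⟨ sumℚ-∷ʳ (map 1/_! (upTo m)) (1/ m !) ⟩
  sumℚ (map 1/_! (upTo m)) + 1/ m !         ∎
  where open ≡-Reasoning

e-partial-expSum : ∀ m → sumℚ (map 1/_! (upTo (suc m))) * ι (m !) ≡ ι (expSum m)
e-partial-expSum zero    = refl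
e-partial-expSum (suc m) = begin
  sumℚ (map 1/_! (upTo (suc (suc m)))) * ι (suc m !)
    ≡⟨ cong (_* ι (suc m !)) (e-partial-suc (suc m)) ⟩
  (s + 1/ suc m !) * ι (suc m !)
    ≡⟨ ℚ.*-distribʳ-+ (ι (suc m !)) s (1/ suc m !) ⟩
  s * ι (suc m !) + 1/ suc m ! * ι (suc m !)
    ≡⟨ cong₂ _+_ (cong (s *_) (ι-* (suc m) (m !))) (/-*-cancel 1 (suc m !) {{suc m ℕ.!≢0}}) ⟩
  s * (ι (suc m) * ι (m !)) + 1ℚ
    ≡⟨ cong (_+ 1ℚ) (solve 3 (λ x y z → x :* (y :* z) := y :* (x :* z)) refl s (ι (suc m)) (ι (m !))) ⟩
  ι (suc m) * (s * ι (m !)) + 1ℚ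
    ≡⟨ cong (λ x → ι (suc m) * x + 1ℚ) (e-partial-expSum m) ⟩
  ι (suc m) * ι (expSum m) + 1ℚ
    ≡⟨ cong (_+ 1ℚ) (ι-* (suc m) (expSum m)) ⟨
  ι (suc m ℕ.* expSum m) + ι 1
    ≡⟨ ι-+ (suc m ℕ.* expSum m) 1 ⟨
  ι (expSum (suc m)) ∎
  where
  open ≡-Reasoning
  s = sumℚ (map 1/_! (upTo (suc m)))

-- The partial sum through 1/m! is strictly below the next one, as 1/(m+1)! is positive. This puts
-- it into the cut e, with `suc (suc m)` terms as the witness.
en/d-intro : ∀ n d m .{{_ : NonZero n}} .{{_ : NonZero d}} .{{_ : NonZero (d ℕ.* m !)}} →
  ((n ·ᴿ e) ÷ᴿ d) (+ (n ℕ.* expSum m) / (d ℕ.* m !))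
en/d-intro n d m = s , (suc (suc m) , s<s′) , *-cancelʳ-≡-pos (ι (m !)) {{ι-pos (m !)}} (begin
  ι d * r * ι (m !)            ≡⟨ solve 3 (λ x y z → x :* y :* z := y :* (x :* z)) refl (ι d) r (ι (m !)) ⟩
  r * (ι d * ι (m !))          ≡⟨ cong (r *_) (ι-* d (m !)) ⟨
  r * ι (d ℕ.* m !)            ≡⟨ /-*-cancel (n ℕ.* expSum m) (d ℕ.* m !) ⟩
  ι (n ℕ.* expSum m)           ≡⟨ ι-* n (expSum m) ⟩
  ι n * ι (expSum m)           ≡⟨ cong (ι n *_) (e-partial-expSum m) ⟨
  ι n * (s * ι (m !))          ≡⟨ ℚ.*-assoc (ι n) s (ι (m !)) ⟨
  ι n * s * ι (m !)            ∎)
  where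
  open ≡-Reasoning
  instance _ = m ℕ.!≢0
  r = + (n ℕ.* expSum m) / (d ℕ.* m !)
  s = sumℚ (map 1/_! (upTo (suc m)))
  1/!-pos : Positive (1/ suc m !)
  1/!-pos = ℚ.normalize-pos 1 (suc m !) {{suc m ℕ.!≢0}}
  s<s′ : s ℚ.< sumℚ (map 1/_! (upTo (suc (suc m))))
  s<s′ = ℚ.≤-<-trans (ℚ.≤-reflexive (sym (ℚ.+-identityʳ s)))
    (ℚ.<-≤-trans (ℚ.+-monoʳ-< s (ℚ.positive⁻¹ (1/ suc m !) {{1/!-pos}})) (ℚ.≤-reflexive (sym (e-partial-suc (suc m)))))

-- Let s be the partial sum of e through 1/d!. Then C(n,d)² ≤ (n s / d)^(2d), and for rationals 1 ≤
-- p′/q′ < n the hypothesis yields (n s / d)^(2d) p′/q′ ≤ 2^t; `square-bound` passes from p′/q′ to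
-- n.
log-bound⇒power-bound : ∀ n d t .{{_ : NonZero n}} .{{_ : NonZero d}} → d < n →
  2 ·ᴿ d ·ᴿ log₂ ((n ·ᴿ e) ÷ᴿ d) +ᴿ log₂ (fromℕ n) ≤ᴿ fromℕ t →
  n choose d ℕ.* n choose d ℕ.* n ℕ.≤ 2 ℕ.^ t
log-bound⇒power-bound n d t d<n hyp = square-bound C n (2 ℕ.^ t) 1<n step
  where
  C = n choose d
  -- The fraction p/q is n s / d with s the sum of 1/i! over i ≤ d.
  p = n ℕ.* expSum d
  q = d ℕ.* d !
  D = 2 ℕ.* d
  1<n : 1 < n
  1<n = ℕ.≤-<-trans (ℕ.>-nonZero⁻¹ d) d<n
  instance
    d!≢0 : NonZero (d !)
    d!≢0 = d ℕ.!≢0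
    q≢0 : NonZero q
    q≢0 = ℕ.m*n≢0 d (d !)
    q^D≢0 : NonZero (q ℕ.^ D)
    q^D≢0 = ℕ.m^n≢0 q D
  q≤p : q ℕ.≤ p
  q≤p = ℕ.*-mono-≤ (ℕ.<⇒≤ d<n) (m!≤expSum d)
  step : ∀ p′ q′ .{{_ : NonZero q′}} → q′ ℕ.≤ p′ → p′ < n ℕ.* q′ → C ℕ.* C ℕ.* p′ ℕ.≤ 2 ℕ.^ t ℕ.* q′
  step p′ q′ q′≤p′ p′<nq′ = ℕ.*-cancelˡ-≤ (q ℕ.^ D) (begin
    q ℕ.^ D ℕ.* (C ℕ.* C ℕ.* p′)                 ≡⟨ cong (λ x → x ℕ.* (C ℕ.* C ℕ.* p′)) (square q) ⟩
    q ℕ.^ d ℕ.* q ℕ.^ d ℕ.* (C ℕ.* C ℕ.* p′)     ≡⟨ rearrange₁ (q ℕ.^ d) C p′ ⟩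
    C ℕ.* q ℕ.^ d ℕ.* (C ℕ.* q ℕ.^ d) ℕ.* p′     ≤⟨ ℕ.*-monoˡ-≤ p′ (ℕ.*-mono-≤ (choose≤[en/d]^d n d) (choose≤[en/d]^d n d)) ⟩
    p ℕ.^ d ℕ.* p ℕ.^ d ℕ.* p′                   ≡⟨ cong (ℕ._* p′) (square p) ⟨
    p ℕ.^ D ℕ.* p′                               ≤⟨ antilog D t q≤p q′≤p′ exponents ⟩
    2 ℕ.^ t ℕ.* (q ℕ.^ D ℕ.* q′)                 ≡⟨ rearrange₂ (2 ℕ.^ t) (q ℕ.^ D) q′ ⟩
    q ℕ.^ D ℕ.* (2 ℕ.^ t ℕ.* q′)                 ∎)
    where
    open ℕ.≤-Reasoning
    square : ∀ x → x ℕ.^ D ≡ x ℕ.^ d ℕ.* x ℕ.^ d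
    square x = trans (cong (λ k → x ℕ.^ (d ℕ.+ k)) (ℕ.+-identityʳ d)) (ℕ.^-distribˡ-+-* x d d)
    rearrange₁ : ∀ x c y → x ℕ.* x ℕ.* (c ℕ.* c ℕ.* y) ≡ c ℕ.* x ℕ.* (c ℕ.* x) ℕ.* y
    rearrange₁ = solve-∀
    rearrange₂ : ∀ x y z → x ℕ.* (y ℕ.* z) ≡ y ℕ.* (x ℕ.* z)
    rearrange₂ = solve-∀
    instance
      p≢0 : NonZero p
      p≢0 = ℕ.>-nonZero (ℕ.<-≤-trans (ℕ.>-nonZero⁻¹ q) q≤p)
      p′≢0 : NonZero p′
      p′≢0 = ℕ.>-nonZero (ℕ.<-≤-trans (ℕ.>-nonZero⁻¹ q′) q′≤p′)
    exponents : ∀ a₁ a₂ b .{{_ : NonZero b}} → 2 ℕ.^ a₁ ℕ.* q ℕ.^ b ℕ.≤ p ℕ.^ b →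
      2 ℕ.^ a₂ ℕ.* q′ ℕ.^ b ℕ.≤ p′ ℕ.^ b → D ℕ.* a₁ ℕ.+ a₂ < t ℕ.* b
    exponents a₁ a₂ b le₁ le₂ = ι-cancel-< (≤R.begin-strict
      ι (D ℕ.* a₁ ℕ.+ a₂)                      ≤R.≡⟨ ι-+ (D ℕ.* a₁) a₂ ⟩
      ι (D ℕ.* a₁) + ι a₂                      ≤R.≡⟨ cong (_+ ι a₂) (trans (ι-* D a₁) (cong (_* ι a₁) (ι-* 2 d))) ⟩
      ι 2 * ι d * ι a₁ + ι a₂                  ≤R.≡⟨ cong₂ (λ x y → ι 2 * ι d * x + y) (/-*-cancel a₁ b) (/-*-cancel a₂ b) ⟨
      ι 2 * ι d * (x₁ * ι b) + x₂ * ι b        ≤R.≡⟨ solve 5 (λ u v x y z → u :* v :* (x :* z) :+ y :* z := (u :* (v :* x) :+ y) :* z) refl (ι 2) (ι d) x₁ x₂ (ι b) ⟩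
      (ι 2 * (ι d * x₁) + x₂) * ι b            ≤R.<⟨ ℚ.*-monoˡ-<-pos (ι b) {{ι-pos b}} below-t ⟩
      ι t * ι b                                ≤R.≡⟨ ι-* t b ⟨
      ι (t ℕ.* b)                              ≤R.∎)
      where
      module ≤R = ℚ.≤-Reasoning
      x₁ = + a₁ / b
      x₂ = + a₂ / b
      below-t : ι 2 * (ι d * x₁) + x₂ ℚ.< ι t
      -- The fractions a₁/b and a₂/b lie in the cuts of the two logarithms, so 2 d a₁/b + a₂/b lies
      -- in the cut of their combination; membership in the cut of t is the strict inequality
      -- wanted.
      below-t = hyp (_ , _ ,
        (_ , (_ , log₂-intro ((n ·ᴿ e) ÷ᴿ d) {p} {q} a₁ b (en/d-intro n d d) le₁ , refl) , refl) ,
        log₂-intro (fromℕ n) {p′} {q′} a₂ b (fromℕ-intro n {p′} {q′} p′<nq′) le₂ , refl)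

-- Sample-injection as uniform counting

uniform≡ : {A : Set} (xs : List A) .{{_ : NonZero (length xs)}} → uniform xs ≡ map (_, + 1 / length xs) xs
uniform≡ (x ∷ xs) = refl

cartesianProductWith-map : {A A′ B B′ C : Set} (h : A′ → B′ → C) (f : A → A′) (g : B → B′) (xs : List A) (ys : List B) →
  cartesianProductWith h (map f xs) (map g ys) ≡ cartesianProductWith (λ x y → h (f x) (g y)) xs ys
cartesianProductWith-map h f g []       ys = refl
cartesianProductWith-map h f g (x ∷ xs) ys = cong₂ _++_ (sym (map-∘ ys)) (cartesianProductWith-map h f g xs ys)

map-cartesianProductWith : {A B C C′ : Set} (k : C → C′) (h : A → B → C) (xs : List A) (ys : List B) →
  map k (cartesianProductWith h xs ys) ≡ cartesianProductWith (λ x y → k (h x y)) xs ys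
map-cartesianProductWith k h []       ys = refl
map-cartesianProductWith k h (x ∷ xs) ys = trans (map-++ k (map (h x) ys) _)
  (cong₂ _++_ (sym (map-∘ ys)) (map-cartesianProductWith k h xs ys))

-- Equal weights of the columns give equal weights to all vectors, so the probability of an event is
-- its count in `vectors` times one constant.
independent≡ : {A : Set} (xs : List A) (q : ℚ) → ∀ n →
  independent (map (_, q) xs) n ≡ map (_, q ^ n) (vectors xs n)
independent≡ xs q zero    = refl
independent≡ xs q (suc n) = begin
  cartesianProductWith _ (map (_, q) xs) (independent (map (_, q) xs) n)
    ≡⟨ cong (cartesianProductWith _ (map (_, q) xs)) (independent≡ xs q n) ⟩
  cartesianProductWith _ (map (_, q) xs) (map (_, q ^ n) (vectors xs n))
    ≡⟨ cartesianProductWith-map _ (_, q) (_, q ^ n) xs (vectors xs n) ⟩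
  cartesianProductWith (λ x v → x Vec.∷ v , q * q ^ n) xs (vectors xs n)
    ≡⟨ map-cartesianProductWith (_, q * q ^ n) Vec._∷_ xs (vectors xs n) ⟨
  map (_, q * q ^ n) (vectors xs (suc n)) ∎
  where open ≡-Reasoning

Pr-equiprobable : {A B : Set} (f : A → B) (xs : List A) (q : ℚ) {P : Pred B 0ℓ} (P? : Decidable P) →
  Pr (mapDist f (map (_, q) xs)) P? ≡ ι (∑ xs (λ x → 𝟙 (P? (f x)))) * q
Pr-equiprobable f []       q P? = sym (ℚ.*-zeroˡ q)
Pr-equiprobable f (x ∷ xs) q P? with does (P? (f x))
... | false = Pr-equiprobable f xs q P?
... | true  = begin
  q + Pr (mapDist f (map (_, q) xs)) P?      ≡⟨ cong₂ _+_ (sym (ℚ.*-identityˡ q)) (Pr-equiprobable f xs q P?) ⟩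
  ι 1 * q + ι k * q                          ≡⟨ ℚ.*-distribʳ-+ q (ι 1) (ι k) ⟨
  (ι 1 + ι k) * q                            ≡⟨ cong (_* q) (ι-+ 1 k) ⟨
  ι (1 ℕ.+ k) * q                            ∎
  where
  open ≡-Reasoning
  k = ∑ xs (λ x → 𝟙 (P? (f x)))

∑𝟙+∑𝟙¬ : {A : Set} (xs : List A) {P : Pred A 0ℓ} (P? : Decidable P) →
  ∑ xs (λ x → 𝟙 (P? x)) ℕ.+ ∑ xs (λ x → 𝟙 (¬? (P? x))) ≡ length xs
∑𝟙+∑𝟙¬ xs P? = trans (sym (∑-+ xs)) (trans (∑-cong xs λ x → complement (P? x)) (sym (length≡∑ xs)))
  where
  complement : {Q : Set} (Q? : Dec Q) → 𝟙 Q? ℕ.+ 𝟙 (¬? Q?) ≡ 1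
  complement (yes _) = refl
  complement (no  _) = refl

-- With Q = 1/N, the b bad outcomes weigh b Q ≤ 1/n, while the total weight (g + b) Q is 1.
1-1/n≤ : ∀ n g b N Q .{{_ : NonZero n}} .{{_ : NonZero N}} → g ℕ.+ b ≡ N → n ℕ.* b ℕ.≤ N → Q * ι N ≡ 1ℚ →
  1ℚ - (+ 1 / n) ≤ ι g * Q
1-1/n≤ n g b N Q g+b≡N nb≤N QN≡1 = begin
  1ℚ - (+ 1 / n)                        ≤⟨ ℚ.+-monoˡ-≤ (ℚ.- (+ 1 / n)) split ⟩
  ι g * Q + (+ 1 / n) - (+ 1 / n)       ≡⟨ solve 2 (λ x y → x :+ y :- y := x) refl (ι g * Q) (+ 1 / n) ⟩
  ι g * Q                               ∎
  where
  open ℚ.≤-Reasoning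
  rare : ι b * Q ≤ + 1 / n
  rare = ℚ.*-cancelʳ-≤-pos (ι n) {{ι-pos n}} (ℚ.*-cancelʳ-≤-pos (ι N) {{ι-pos N}} (begin
    ι b * Q * ι n * ι N          ≡⟨ solve 4 (λ b q n N → b :* q :* n :* N := n :* b :* (q :* N)) refl (ι b) Q (ι n) (ι N) ⟩
    ι n * ι b * (Q * ι N)        ≡⟨ cong₂ _*_ (sym (ι-* n b)) QN≡1 ⟩
    ι (n ℕ.* b) * 1ℚ             ≡⟨ ℚ.*-identityʳ _ ⟩
    ι (n ℕ.* b)                  ≤⟨ ι-mono-≤ nb≤N ⟩
    ι N                          ≡⟨ ℚ.*-identityˡ (ι N) ⟨
    1ℚ * ι N                     ≡⟨ cong (_* ι N) (/-*-cancel 1 n) ⟨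
    (+ 1 / n) * ι n * ι N        ∎))
  split : 1ℚ ≤ ι g * Q + (+ 1 / n)
  split = begin
    1ℚ                       ≡⟨ QN≡1 ⟨
    Q * ι N                  ≡⟨ cong (λ k → Q * ι k) g+b≡N ⟨
    Q * ι (g ℕ.+ b)          ≡⟨ cong (Q *_) (ι-+ g b) ⟩
    Q * (ι g + ι b)          ≡⟨ solve 3 (λ q x y → q :* (x :+ y) := x :* q :+ y :* q) refl Q (ι g) (ι b) ⟩
    ι g * Q + ι b * Q        ≤⟨ ℚ.+-monoʳ-≤ (ι g * Q) rare ⟩
    ι g * Q + (+ 1 / n)      ∎

corollary2 : (n d t : ℕ) .{{_ : NonZero n}} .{{_ : NonZero d}} .{{_ : NonZero t}} →
    d < n → d ∣ t →
    2 ·ᴿ d ·ᴿ log₂ ((n ·ᴿ e) ÷ᴿ d) +ᴿ log₂ (fromℕ n) ≤ᴿ fromℕ t →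
    1ℚ - (+ 1 / n) ≤ Pr (sampleInjection n d t) (resolvable? d d)
corollary2 n d t d<n d∣t hyp = subst (1ℚ - (+ 1 / n) ≤_) (sym Pr≡)
  (1-1/n≤ n good bad (N ℕ.^ n) (q ^ n) good+bad n*bad≤ q^n*N^n≡1)
  where
  w = t ℕ./ d
  L = subsetsOfSize (2 ℕ.* t) w
  N = length L
  V = vectors L n
  good = ∑ V (λ v → 𝟙 (resolvable? d d (fromColumns v)))
  bad = ∑ V (λ v → 𝟙 (¬? (resolvable? d d (fromColumns v))))
  wd≡t : w ℕ.* d ≡ t
  wd≡t = ℕ.m/n*n≡m d∣t
  w≤2t : w ℕ.≤ 2 ℕ.* t
  w≤2t = ℕ.≤-trans (ℕ.m/n≤m t d) (ℕ.m≤n*m t 2)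
  instance
    N≢0 : NonZero N
    N≢0 = subsetsOfSize≢0 (2 ℕ.* t) w w≤2t
    N^n≢0 : NonZero (N ℕ.^ n)
    N^n≢0 = ℕ.m^n≢0 N n
  q = + 1 / N
  Pr≡ : Pr (sampleInjection n d t) (resolvable? d d) ≡ ι good * q ^ n
  Pr≡ = trans
    (cong (λ μ → Pr (mapDist fromColumns μ) (resolvable? d d))
      (trans (cong (λ μ → independent μ n) (uniform≡ L)) (independent≡ L q n)))
    (Pr-equiprobable fromColumns V (q ^ n) (resolvable? d d))
  good+bad : good ℕ.+ bad ≡ N ℕ.^ n
  good+bad = trans (∑𝟙+∑𝟙¬ V (λ v → resolvable? d d (fromColumns v))) (length-vectors L n)
  q^n*N^n≡1 : q ^ n * ι (N ℕ.^ n) ≡ 1ℚ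
  q^n*N^n≡1 = begin
    q ^ n * ι (N ℕ.^ n)   ≡⟨ cong (q ^ n *_) (ι-^ N n) ⟩
    q ^ n * ι N ^ n       ≡⟨ ^-distrib-* q (ι N) n ⟨
    (q * ι N) ^ n         ≡⟨ cong (_^ n) (/-*-cancel 1 N) ⟩
    ι 1 ^ n               ≡⟨ ι-^ 1 n ⟨
    ι (1 ℕ.^ n)           ≡⟨ cong ι (ℕ.^-zeroˡ n) ⟩
    1ℚ                    ∎
    where open ≡-Reasoning
  C = n choose d
  count : 2 ℕ.^ t ℕ.* bad ℕ.≤ C ℕ.* C ℕ.* N ℕ.^ n
  -- The count is stated for w d in place of t; it is transported along (t / d) d = t, which holds
  -- as d divides t.
  count = subst
    (λ s → 2 ℕ.^ s ℕ.* ∑ (vectors (subsetsOfSize (2 ℕ.* s) w) n) (λ v → 𝟙 (¬? (resolvable? d d (fromColumns v))))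
      ℕ.≤ C ℕ.* C ℕ.* length (subsetsOfSize (2 ℕ.* s) w) ℕ.^ n)
    wd≡t (unresolvable-count n d w)
  n*bad≤ : n ℕ.* bad ℕ.≤ N ℕ.^ n
  n*bad≤ = ℕ.*-cancelˡ-≤ (2 ℕ.^ t) {{ℕ.m^n≢0 2 t}} (begin
    2 ℕ.^ t ℕ.* (n ℕ.* bad)             ≡⟨ rearrange₁ (2 ℕ.^ t) n bad ⟩
    n ℕ.* (2 ℕ.^ t ℕ.* bad)             ≤⟨ ℕ.*-monoʳ-≤ n count ⟩
    n ℕ.* (C ℕ.* C ℕ.* N ℕ.^ n)         ≡⟨ rearrange₂ n (C ℕ.* C) (N ℕ.^ n) ⟩
    C ℕ.* C ℕ.* n ℕ.* N ℕ.^ n           ≤⟨ ℕ.*-monoˡ-≤ (N ℕ.^ n) (log-bound⇒power-bound n d t d<n hyp) ⟩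
    2 ℕ.^ t ℕ.* N ℕ.^ n                 ∎)
    where
    open ℕ.≤-Reasoning
    rearrange₁ : ∀ x y z → x ℕ.* (y ℕ.* z) ≡ y ℕ.* (x ℕ.* z)
    rearrange₁ = solve-∀
    rearrange₂ : ∀ x y z → x ℕ.* (y ℕ.* z) ≡ y ℕ.* x ℕ.* z
    rearrange₂ = solve-∀
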